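{- Let $m, k, n$ be positive integers and let $G = K_m \vee C_{2k+1}$. Then $AT(G \square P_n) = m+3$. Consequently, $(K_m \vee C_{2k+1}) \square P_n$ is chromatic-choosable, i.e. its chromatic number equals its list chromatic number.
   Context: All graphs are finite and simple, and digraphs are simple. $K_m$ is the complete graph on $m$ vertices, $C_{2k+1}$ the cycle on $2k+1$ vertices, $P_n$ the path on $n$ vertices. The join $G_1 \vee G_2$ of vertex-disjoint graphs consists of $G_1$, $G_2$ and all edges between a vertex of $G_1$ and a vertex of $G_2$. The Cartesian product $G \square H$ has vertex set $V(G)\times V(H)$, with $(u,v)$ adjacent to $(u',v')$ iff either $u=u'$ and $vv'\in E(H)$, or $v=v'$ and $uu'\in E(G)$. A circulation contained in a digraph $D$ is a spanning subdigraph $E$ of $D$ such that $d^-_E(v)=d^+_E(v)$ (indegree equals outdegree in $E$) for every $v\in V(D)$; it is even (resp. odd) if it has an even (resp. odd) number of edges (the edgeless circulation is even). The Alon-Tarsi number $AT(G)$ is the smallest $k$ for which there is an orientation $D$ of $G$ with maximum indegree $k-1$ such that the number of even circulations and the number of odd circulations contained in $D$ are different. The list chromatic number $\chi_\ell(G)$ is the smallest $k$ such that for every assignment $L$ of lists of colors to the vertices with $|L(v)|\ge k$ for all $v$, there is a proper coloring $f$ of $G$ with $f(v)\in L(v)$ for all $v$. A graph $G$ is chromatic-choosable if $\chi(G)=\chi_\ell(G)$, where $\chi(G)$ is the chromatic number. -}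

module Defs where

open import Data.Fin using (Fin; toℕ)
import Data.Fin.Properties as Fin
open import Data.List using (List; []; _∷_; _++_; map; filter; length; allFin; cartesianProduct)
open import Data.List.Extrema.Nat using (max)
open import Data.List.Membership.Propositional using (_∈_)
open import Data.List.Relation.Unary.Unique.Propositional using (Unique)
open import Data.Nat using (ℕ; suc; _+_; _*_; _≤_; _≟_)
open import Data.Nat.Divisibility using (_∣_; _∣?_)
open import Data.Product using (∃-syntax; _×_; _,_; proj₁; proj₂)
open import Data.Product.Function.NonDependent.Propositional using (_×-↔_)
open import Data.Sum using (_⊎_; inj₁; inj₂; swap)
open import Data.Sum.Function.Propositional using (_⊎-↔_)
open import Data.Unit using (⊤; tt)
open import Function.Bundles using (_↔_; module Inverse)
open import Function.Construct.Composition using (_↔-∘_)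
open import Function.Construct.Identity using (↔-id)
open import Function.Construct.Symmetry using (↔-sym)
open import Function.Properties.Inverse using (↔⇒↣)
open import Level using (Level; 0ℓ)
open import Relation.Binary.Core using (Rel)
open import Relation.Binary.Definitions using (Decidable; DecidableEquality; Symmetric; Irreflexive)
open import Relation.Binary.PropositionalEquality using (_≡_; _≢_; refl; sym; subst)
open import Relation.Nullary using (¬_; Dec; yes; no)
open import Relation.Nullary.Decidable using (map′; _×-dec_; _⊎-dec_; ¬?)
import Relation.Unary as U

private
  variable
    ℓ : Level

record FiniteSimpleGraph : Set₁ where
  field
    V       : Set
    size    : ℕ
    index   : V ↔ Fin size
    _~_     : Rel V 0ℓ
    _~?_    : Decidable _~_
    ~-sym   : Symmetric _~_
    ~-irrefl : Irreflexive _≡_ _~_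

  vertex : Fin size → V
  vertex = Inverse.from index

  vertices : List V
  vertices = map vertex (allFin size)

  _≟ᵥ_ : DecidableEquality V
  _≟ᵥ_ = Fin.inj⇒≟ (↔⇒↣ index)

  allᵥ? : {Q : V → Set} → U.Decidable Q → Dec (∀ v → Q v)
  allᵥ? {Q} Q? = map′
    (λ h v → subst Q (Inverse.strictlyInverseʳ index v) (h (Inverse.to index v)))
    (λ h i → h (vertex i))
    (Fin.all? (λ i → Q? (vertex i)))

open FiniteSimpleGraph using (V)

-- The simple graph generated by an arbitrary relation: directions are forgotten and
-- loops are discarded.
fromRel : (n : ℕ) {R : Rel (Fin n) 0ℓ} → Decidable R → FiniteSimpleGraph
fromRel n {R} R? = record
  { V        = Fin n
  ; size     = n
  ; index    = ↔-id (Fin n)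
  ; _~_      = λ i j → i ≢ j × (R i j ⊎ R j i)
  ; _~?_     = λ i j → ¬? (i Fin.≟ j) ×-dec (R? i j ⊎-dec R? j i)
  ; ~-sym    = λ (i≢j , r) → (λ j≡i → i≢j (sym j≡i)) , swap r
  ; ~-irrefl = λ i≡j (i≢j , _) → i≢j i≡j
  }

K : ℕ → FiniteSimpleGraph
K n = fromRel n {λ _ _ → ⊤} (λ _ _ → yes tt)

-- P n has n vertices (and n ∸ 1 edges).
P : ℕ → FiniteSimpleGraph
P n = fromRel n (λ i j → suc (toℕ i) ≟ toℕ j)

-- This is the cycle on n vertices for n ≥ 3.
C : ℕ → FiniteSimpleGraph
C n = fromRel n (λ i j →
  (suc (toℕ i) ≟ toℕ j) ⊎-dec ((suc (toℕ i) ≟ n) ×-dec (toℕ j ≟ 0)))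

infixr 6 _∨_
infixr 7 _□_

_∨_ : FiniteSimpleGraph → FiniteSimpleGraph → FiniteSimpleGraph
G ∨ H = record
  { V        = G.V ⊎ H.V
  ; size     = G.size + H.size
  ; index    = ↔-sym Fin.+↔⊎ ↔-∘ (G.index ⊎-↔ H.index)
  ; _~_      = _~_
  ; _~?_     = _~?_
  ; ~-sym    = λ {x} {y} → ~-sym x y
  ; ~-irrefl = λ { {x} refl → ~-irrefl x }
  }
  where
  module G = FiniteSimpleGraph G
  module H = FiniteSimpleGraph H

  _~_ : Rel (G.V ⊎ H.V) 0ℓ
  inj₁ u ~ inj₁ u′ = u G.~ u′
  inj₁ _ ~ inj₂ _  = ⊤
  inj₂ _ ~ inj₁ _  = ⊤
  inj₂ v ~ inj₂ v′ = v H.~ v′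

  _~?_ : Decidable _~_
  inj₁ u ~? inj₁ u′ = u G.~? u′
  inj₁ _ ~? inj₂ _  = yes tt
  inj₂ _ ~? inj₁ _  = yes tt
  inj₂ v ~? inj₂ v′ = v H.~? v′

  ~-sym : ∀ x y → x ~ y → y ~ x
  ~-sym (inj₁ _) (inj₁ _) e = G.~-sym e
  ~-sym (inj₁ _) (inj₂ _) _ = tt
  ~-sym (inj₂ _) (inj₁ _) _ = tt
  ~-sym (inj₂ _) (inj₂ _) e = H.~-sym e

  ~-irrefl : ∀ x → ¬ (x ~ x)
  ~-irrefl (inj₁ _) = G.~-irrefl refl
  ~-irrefl (inj₂ _) = H.~-irrefl refl

_□_ : FiniteSimpleGraph → FiniteSimpleGraph → FiniteSimpleGraph
G □ H = record
  { V        = G.V × H.V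
  ; size     = G.size * H.size
  ; index    = ↔-sym Fin.*↔× ↔-∘ (G.index ×-↔ H.index)
  ; _~_      = λ (u , v) (u′ , v′) → (u ≡ u′ × v H.~ v′) ⊎ (v ≡ v′ × u G.~ u′)
  ; _~?_     = λ (u , v) (u′ , v′) →
                 ((u G.≟ᵥ u′) ×-dec (v H.~? v′)) ⊎-dec ((v H.≟ᵥ v′) ×-dec (u G.~? u′))
  ; ~-sym    = λ { (inj₁ (p , e)) → inj₁ (sym p , H.~-sym e)
                 ; (inj₂ (p , e)) → inj₂ (sym p , G.~-sym e) }
  ; ~-irrefl = λ { refl (inj₁ (_ , e)) → H.~-irrefl refl e
                 ; refl (inj₂ (_ , e)) → G.~-irrefl refl e }
  }
  where
  module G = FiniteSimpleGraph G
  module H = FiniteSimpleGraph H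

IsLeast : (ℕ → Set ℓ) → ℕ → Set ℓ
IsLeast Q k = Q k × (∀ j → Q j → k ≤ j)

-- Applied to a duplicate-free list, this lists every subset of its elements exactly once.
sublists : {A : Set} → List A → List (List A)
sublists []       = [] ∷ []
sublists (x ∷ xs) = map (x ∷_) (sublists xs) ++ sublists xs

module _ (G : FiniteSimpleGraph) where
  open FiniteSimpleGraph G hiding (V)

  record Orientation : Set₁ where
    field
      _⇾_    : Rel (V G) 0ℓ
      _⇾?_   : Decidable _⇾_
      sound  : ∀ {u v} → u ⇾ v → u ~ v
      total  : ∀ {u v} → u ~ v → u ⇾ v ⊎ v ⇾ u
      asym   : ∀ {u v} → u ⇾ v → ¬ (v ⇾ u)

  -- A list of arcs (u , v), directed from u to v, stands for the spanning digraph
  -- with exactly these arcs.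
  indegree outdegree : List (V G × V G) → V G → ℕ
  indegree  es v = length (filter (λ e → proj₂ e ≟ᵥ v) es)
  outdegree es v = length (filter (λ e → proj₁ e ≟ᵥ v) es)

  IsCirculation : List (V G × V G) → Set
  IsCirculation es = ∀ v → indegree es v ≡ outdegree es v

  isCirculation? : U.Decidable IsCirculation
  isCirculation? es = allᵥ? (λ v → indegree es v ≟ outdegree es v)

  module _ (D : Orientation) where
    open Orientation D

    arcs : List (V G × V G)
    arcs = filter (λ (u , v) → u ⇾? v) (cartesianProduct vertices vertices)

    maxIndegree : ℕ
    maxIndegree = max 0 (map (indegree arcs) vertices)

    circulations : List (List (V G × V G))
    circulations = filter isCirculation? (sublists arcs)

    #evenCirculations #oddCirculations : ℕ
    #evenCirculations = length (filter (λ es → 2 ∣? length es) circulations)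
    #oddCirculations  = length (filter (λ es → ¬? (2 ∣? length es)) circulations)

  -- suc (maxIndegree D) ≡ k rather than maxIndegree D ≡ k ∸ 1, so that k = 0 is excluded.
  HasAlonTarsiOrientation : ℕ → Set₁
  HasAlonTarsiOrientation k =
    ∃[ D ] suc (maxIndegree D) ≡ k × #evenCirculations D ≢ #oddCirculations D

  IsAlonTarsiNumber : ℕ → Set₁
  IsAlonTarsiNumber = IsLeast HasAlonTarsiOrientation

  IsProper : {A : Set} → (V G → A) → Set
  IsProper f = ∀ {u v} → u ~ v → f u ≢ f v

  Colorable : ℕ → Set
  Colorable k = ∃[ f ] IsProper {Fin k} f

  -- Colors are natural numbers; a list of k colors is a k-element set, hence Unique.
  Choosable : ℕ → Set
  Choosable k = (L : V G → List ℕ) → (∀ v → Unique (L v)) → (∀ v → k ≤ length (L v)) →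
    ∃[ f ] IsProper f × (∀ v → f v ∈ L v)

  IsChromaticNumber IsListChromaticNumber : ℕ → Set
  IsChromaticNumber     = IsLeast Colorable
  IsListChromaticNumber = IsLeast Choosable

  ChromaticChoosable : Set
  ChromaticChoosable = ∃[ k ] IsChromaticNumber k × IsListChromaticNumber k

-- Upper bound.  Orient (K m ∨ C N) □ P n with N = 2k+1 as follows: K m □ P n acyclically, the
-- edges of the joins from K m to the cycles, every copy of C N as a directed cycle except that
-- one arc of the first copy is reversed, and the copies of P n in C N □ P n away from the first
-- layer at one vertex 0 of C N and towards it at all other vertices.  All indegrees are at most
-- m + 2, so by the Alon–Tarsi theorem it suffices that the number of circulations is odd.  A
-- circulation lives on C N □ P n; between consecutive layers it uses either no vertical arc or
-- the one at 0 and one returning at some j ≠ 0 (put j = 0 in the first case).  Within a layer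
-- that is entered at j and left towards the next one at j′ there are modulo 2 exactly [j ≠ j′]
-- ways to complete it, and since N is odd the matrix ([j ≠ j′]) is idempotent modulo 2, so the
-- number of layers does not matter; the reversed arc makes the first layer start at some j ≠ 0.
--
-- Alon–Tarsi theorem.  Choose d(v) + 1 colours from the list of v, where d is the indegree, and
-- weights on them, proportional to a divided difference of order d(v), which annihilate the
-- powers x^i with i < d(v) but not x^d(v).  Expanding ∏ (x_v - x_u) over the arcs, the weighted
-- sum of its values at all choices of colours is (EE - EO) times a nonzero number, because every
-- set of arcs other than a circulation contributes a monomial with an exponent below d(v) at
-- some v.  So some choice of colours gives a nonzero product, that is, a proper colouring.
--
-- Lower bound.  Some three consecutive vertices of an odd cycle get distinct colours, so K m ∨ C N
-- needs m + 3 colours, and by the Alon–Tarsi theorem AT bounds the chromatic number.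

module Submission where

open import Defs
open import Algebra.Bundles using (CommutativeMonoid; CommutativeRing)
import Algebra.Properties.CommutativeMonoid.Sum
import Algebra.Properties.CommutativeSemigroup
import Algebra.Properties.Semiring.Sum
open import Data.Bool using (Bool; true; false; not; if_then_else_; _xor_; _∧_)
import Data.Bool.Properties as Bool
open import Data.Empty using (⊥)
open import Data.Fin as Fin using (Fin; zero; suc; toℕ; fromℕ; fromℕ<; inject₁; inject≤)
import Data.Fin.Properties as Fin
open import Data.Integer using (ℤ; 0ℤ; 1ℤ; -1ℤ; _+_; _*_; _-_; -_; _^_) renaming (+_ to pos)
import Data.Integer as ℤ
import Data.Integer.Properties as ℤ
open import Data.Integer.Tactic.RingSolver using (solve-∀)
open import Data.List using (List; []; _∷_; _++_; map; filter; foldr; length; lookup; tabulate; allFin; upTo; cartesianProduct)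
open import Data.List.Extrema.Nat using (xs≤max; max≤v⁺)
open import Data.List.Membership.Propositional using (_∈_)
open import Data.List.Membership.Propositional.Properties
  using (∈-map⁺; ∈-allFin; ∈-++⁺ˡ; ∈-++⁺ʳ; ∈-tabulate⁺; ∈-filter⁺; ∈-filter⁻; ∈-cartesianProduct⁺; ∈-lookup; ∈-upTo⁻)
open import Data.List.Membership.Propositional.Properties.WithK using (unique∧set⇒bag)
open import Data.List.Properties
  using (filter-accept; filter-reject; filter-++; length-++; length-map; length-tabulate; length-upTo)
open import Data.List.Relation.Binary.BagAndSetEquality using (∼bag⇒↭)
open import Data.List.Relation.Binary.Disjoint.Propositional using (Disjoint)
open import Data.List.Relation.Binary.Permutation.Propositional as ↭ using (_↭_)
open import Data.List.Relation.Binary.Permutation.Propositional.Properties using (shifts)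
open import Data.List.Relation.Binary.Sublist.Propositional using (_⊆_; []; _∷_; _∷ʳ_)
import Data.List.Relation.Binary.Sublist.Propositional.Properties as Sublist
open import Data.List.Relation.Unary.All as All using (All; []; _∷_)
import Data.List.Relation.Unary.All.Properties as All
open import Data.List.Relation.Unary.Any as Any using (here; there)
open import Data.List.Relation.Unary.Any.Properties using (lookup-index)
open import Data.List.Relation.Unary.Unique.Propositional using (Unique; []; _∷_)
import Data.List.Relation.Unary.Unique.Propositional.Properties as Unique
open import Data.Nat as ℕ using (ℕ; zero; suc; _<_; _≤_; s≤s; z≤n; _∸_; NonZero)
open import Data.Nat.Divisibility using (_∣_; _∣?_; divides)
import Data.Nat.Properties as ℕ
open import Data.Nat.Tactic.RingSolver using () renaming (solve-∀ to solveℕ-∀)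
open import Data.Product using (∃-syntax; Σ-syntax; _×_; _,_; proj₁; proj₂)
open import Data.Sum using (_⊎_; inj₁; inj₂; [_,_]′) renaming (swap to swap⊎)
open import Data.Vec.Functional using (updateAt) renaming (_∷_ to _◂_)
open import Data.Vec.Functional.Properties using (updateAt-updates; updateAt-minimal)
open import Function using (_∘_; Injective)
open import Function.Bundles using (Inverse; mk⇔)
open import Level using (0ℓ)
open import Relation.Binary.Core using (Rel)
open import Relation.Binary.Definitions using (Decidable; tri<; tri≈; tri>)
open import Relation.Binary.PropositionalEquality
open import Relation.Nullary using (¬_; Dec; yes; no; does; contradiction)
open import Relation.Nullary.Decidable
  using (¬?; _×-dec_; _⊎-dec_; decidable-stable; does-⇔; dec-true; dec-false)
import Relation.Unary as U

module ∑ = Algebra.Properties.Semiring.Sum ℤ.+-*-semiring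
open ∑ using (sum)

open Algebra.Properties.CommutativeSemigroup
  (CommutativeMonoid.commutativeSemigroup (CommutativeRing.+-commutativeMonoid Bool.xor-∧-commutativeRing))
  using (interchange)
open Algebra.Properties.CommutativeSemigroup ℤ.*-commutativeSemigroup using (x∙yz≈y∙xz; xy∙z≈xz∙y)

-- Divided differences

*≢0 : ∀ {x y} → x ≢ 0ℤ → y ≢ 0ℤ → x * y ≢ 0ℤ
*≢0 {x} x≢0 y≢0 xy≡0 = [ x≢0 , y≢0 ]′ (ℤ.i*j≡0⇒i≡0∨j≡0 x xy≡0)

-- Clears denominators: `q i` stands for the integer `M / f i`, so that divided differences can be
-- formed without leaving the integers.
commonMultiple : ∀ {n} (f : Fin n → ℤ) → (∀ i → f i ≢ 0ℤ) →
  ∃[ M ] M ≢ 0ℤ × Σ[ q ∈ (Fin n → ℤ) ] ∀ i → q i * f i ≡ M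
commonMultiple {zero}  f f≢0 = 1ℤ , (λ ()) , (λ ()) , λ ()
commonMultiple {suc n} f f≢0 with commonMultiple (f ∘ suc) (f≢0 ∘ suc)
... | M , M≢0 , q , qf≡M =
  M * f zero , *≢0 M≢0 (f≢0 zero) , (M ◂ λ i → q i * f zero) , λ where
    zero    → refl
    (suc i) → trans (xy∙z≈xz∙y (q i) (f zero) (f (suc i))) (cong (_* f zero) (qf≡M i))

moment : ∀ {n} (w s : Fin n → ℤ) → ℕ → ℤ
moment w s j = sum λ i → w i * s i ^ j

-- The value of (x ^ j - t ^ j) / (x - t), also defined for x = t.
quotient : ℤ → ℤ → ℕ → ℤ
quotient t x zero    = 0ℤ
quotient t x (suc j) = x ^ j + t * quotient t x j

quotient-correct : ∀ t x j → x ^ j - t ^ j ≡ (x - t) * quotient t x j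
quotient-correct t x zero    = sym (ℤ.*-zeroʳ (x - t))
quotient-correct t x (suc j) = begin
  x * x ^ j - t * t ^ j                              ≡⟨ split t x (x ^ j) (t ^ j) ⟩
  (x - t) * x ^ j + t * (x ^ j - t ^ j)              ≡⟨ cong (λ y → (x - t) * x ^ j + t * y) (quotient-correct t x j) ⟩
  (x - t) * x ^ j + t * ((x - t) * quotient t x j)   ≡⟨ collect t x (x ^ j) (quotient t x j) ⟩
  (x - t) * (x ^ j + t * quotient t x j)             ∎
  where
  open ≡-Reasoning
  split : ∀ t x a b → x * a - t * b ≡ (x - t) * a + t * (a - b)
  split = solve-∀
  collect : ∀ t x a b → (x - t) * a + t * ((x - t) * b) ≡ (x - t) * (a + t * b)
  collect = solve-∀

-- Integer multiples of the coefficients of the divided difference of order d.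
weights : ∀ d (s : Fin (suc d) → ℤ) → Injective _≡_ _≡_ s →
  Σ[ w ∈ (Fin (suc d) → ℤ) ] (∀ j → j < d → moment w s j ≡ 0ℤ) × moment w s d ≢ 0ℤ
weights zero    s s-inj = (λ _ → 1ℤ) , (λ _ ()) , λ ()
weights (suc d) s s-inj
  with weights d (s ∘ suc) (λ eq → Fin.suc-injective (s-inj eq))
     | commonMultiple (λ i → s (suc i) - s zero)
         (λ i eq → Fin.0≢1+n (sym (s-inj (ℤ.i-j≡0⇒i≡j _ _ eq))))
... | w , w-kills , w-leads | M , M≢0 , q , q*s≡M = w′ , kills , leads
  where
  open ≡-Reasoning
  t = s zero
  s′ = s ∘ suc
  -- These weights apply `w` to `(x ^ j - t ^ j) / (x - t)`, scaled by `M`; the weight at `t` makes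
  -- the total weight zero.
  w′ = - (sum λ i → w i * q i) ◂ λ i → w i * q i

  η : ℕ → ℤ
  η j = sum λ i → w i * quotient t (s′ i) j

  moment-w′ : ∀ j → moment w′ s j ≡ M * η j
  moment-w′ j = begin
    - (sum λ i → w i * q i) * t ^ j + sum (λ i → w i * q i * s′ i ^ j)
      ≡⟨ cong (_+ sum (λ i → w i * q i * s′ i ^ j))
           (trans (flip (sum λ i → w i * q i) (t ^ j)) (∑.*-distribˡ-sum (- (t ^ j)) (λ i → w i * q i))) ⟩
    sum (λ i → - (t ^ j) * (w i * q i)) + sum (λ i → w i * q i * s′ i ^ j)
      ≡⟨ ∑.∑-distrib-+ (λ i → - (t ^ j) * (w i * q i)) (λ i → w i * q i * s′ i ^ j) ⟨
    sum (λ i → - (t ^ j) * (w i * q i) + w i * q i * s′ i ^ j)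
      ≡⟨ ∑.sum-cong-≗ termwise ⟩
    sum (λ i → M * (w i * quotient t (s′ i) j))
      ≡⟨ ∑.*-distribˡ-sum M (λ i → w i * quotient t (s′ i) j) ⟨
    M * η j ∎
    where
    flip : ∀ a b → - a * b ≡ - b * a
    flip = solve-∀
    factor : ∀ a b c d → - a * (b * c) + b * c * d ≡ b * (c * (d - a))
    factor = solve-∀
    regroup : ∀ a b c d → a * (b * (c * d)) ≡ b * c * (a * d)
    regroup = solve-∀
    termwise : ∀ i → - (t ^ j) * (w i * q i) + w i * q i * s′ i ^ j ≡ M * (w i * quotient t (s′ i) j)
    termwise i = begin
      - (t ^ j) * (w i * q i) + w i * q i * s′ i ^ j  ≡⟨ factor (t ^ j) (w i) (q i) (s′ i ^ j) ⟩
      w i * (q i * (s′ i ^ j - t ^ j))                ≡⟨ cong (λ y → w i * (q i * y)) (quotient-correct t (s′ i) j) ⟩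
      w i * (q i * ((s′ i - t) * quotient t (s′ i) j)) ≡⟨ regroup (w i) (q i) (s′ i - t) _ ⟩
      q i * (s′ i - t) * (w i * quotient t (s′ i) j)  ≡⟨ cong (_* (w i * quotient t (s′ i) j)) (q*s≡M i) ⟩
      M * (w i * quotient t (s′ i) j)                 ∎

  η-suc : ∀ j → η (suc j) ≡ moment w s′ j + t * η j
  η-suc j = begin
    sum (λ i → w i * (s′ i ^ j + t * quotient t (s′ i) j))
      ≡⟨ ∑.sum-cong-≗ (λ i → distrib (w i) (s′ i ^ j) t (quotient t (s′ i) j)) ⟩
    sum (λ i → w i * s′ i ^ j + t * (w i * quotient t (s′ i) j))
      ≡⟨ ∑.∑-distrib-+ (λ i → w i * s′ i ^ j) (λ i → t * (w i * quotient t (s′ i) j)) ⟩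
    moment w s′ j + sum (λ i → t * (w i * quotient t (s′ i) j))
      ≡⟨ cong (moment w s′ j +_) (∑.*-distribˡ-sum t (λ i → w i * quotient t (s′ i) j)) ⟨
    moment w s′ j + t * η j ∎
    where
    distrib : ∀ a b c d → a * (b + c * d) ≡ a * b + c * (a * d)
    distrib = solve-∀

  -- Dividing by `x - t` lowers the degree by one, so `η` vanishes up to and including `d` although
  -- `w` is only known to kill exponents below `d`.
  η≡0 : ∀ j → j ≤ d → η j ≡ 0ℤ
  η≡0 zero    _   = trans (∑.sum-cong-≗ (λ i → ℤ.*-zeroʳ (w i))) (∑.sum-replicate-zero (suc d))
  η≡0 (suc j) j<d = begin
    η (suc j)                   ≡⟨ η-suc j ⟩
    moment w s′ j + t * η j     ≡⟨ cong₂ (λ a b → a + t * b) (w-kills j j<d) (η≡0 j (ℕ.<⇒≤ j<d)) ⟩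
    0ℤ + t * 0ℤ                 ≡⟨ cong (0ℤ +_) (ℤ.*-zeroʳ t) ⟩
    0ℤ                          ∎

  kills : ∀ j → j < suc d → moment w′ s j ≡ 0ℤ
  kills j (s≤s j≤d) = trans (moment-w′ j) (trans (cong (M *_) (η≡0 j j≤d)) (ℤ.*-zeroʳ M))

  η-top : η (suc d) ≡ moment w s′ d
  η-top = begin
    η (suc d)                 ≡⟨ η-suc d ⟩
    moment w s′ d + t * η d   ≡⟨ cong (λ y → moment w s′ d + t * y) (η≡0 d ℕ.≤-refl) ⟩
    moment w s′ d + t * 0ℤ    ≡⟨ cong (moment w s′ d +_) (ℤ.*-zeroʳ t) ⟩
    moment w s′ d + 0ℤ        ≡⟨ ℤ.+-identityʳ _ ⟩
    moment w s′ d             ∎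

  leads : moment w′ s (suc d) ≢ 0ℤ
  leads eq = *≢0 M≢0 w-leads (trans (cong (M *_) (sym η-top)) (trans (sym (moment-w′ (suc d))) eq))

-- Products, monomials and weighted sums over all choices of colours

module ∏ = Algebra.Properties.CommutativeMonoid.Sum ℤ.*-1-commutativeMonoid
open ∏ using () renaming (sum to product)

module ∑ℕ = Algebra.Properties.CommutativeMonoid.Sum ℕ.+-0-commutativeMonoid

product-zero : ∀ {n} (f : Fin n → ℤ) i → f i ≡ 0ℤ → product f ≡ 0ℤ
product-zero f zero    eq = cong (_* product (f ∘ suc)) eq
product-zero f (suc i) eq = trans (cong (f zero *_) (product-zero (f ∘ suc) i eq)) (ℤ.*-zeroʳ (f zero))

product≢0 : ∀ {n} (f : Fin n → ℤ) → (∀ i → f i ≢ 0ℤ) → product f ≢ 0ℤ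
product≢0 {zero}  f f≢0 = λ ()
product≢0 {suc n} f f≢0 = *≢0 (f≢0 zero) (product≢0 (f ∘ suc) (f≢0 ∘ suc))

sum≢0⇒term≢0 : ∀ {n} (f : Fin n → ℤ) → sum f ≢ 0ℤ → ∃[ i ] f i ≢ 0ℤ
sum≢0⇒term≢0 {zero}  f ∑≢0 = contradiction refl ∑≢0
sum≢0⇒term≢0 {suc n} f ∑≢0 with f zero ℤ.≟ 0ℤ
... | no  f0≢0 = zero , f0≢0
... | yes f0≡0 with sum≢0⇒term≢0 (f ∘ suc) (λ eq → ∑≢0 (cong₂ _+_ f0≡0 eq))
...   | i , fi≢0 = suc i , fi≢0

-- The tensor product of the functionals with nodes `s i` and weights `w i`, evaluated at `F`.
multisum : ∀ {n} (d : Fin n → ℕ) (s w : ∀ i → Fin (suc (d i)) → ℤ) → ((Fin n → ℤ) → ℤ) → ℤ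
multisum {zero}  d s w F = F λ ()
multisum {suc n} d s w F = sum λ a →
  w zero a * multisum (d ∘ suc) (λ i → s (suc i)) (λ i → w (suc i)) (λ c → F (s zero a ◂ c))

multisum-cong : ∀ {n} (d : Fin n → ℕ) s w {F G : (Fin n → ℤ) → ℤ} → (∀ c → F c ≡ G c) →
  multisum d s w F ≡ multisum d s w G
multisum-cong {zero}  d s w F≗G = F≗G _
multisum-cong {suc n} d s w F≗G =
  ∑.sum-cong-≗ λ a → cong (w zero a *_) (multisum-cong (d ∘ suc) (λ i → s (suc i)) (λ i → w (suc i)) λ c → F≗G (s zero a ◂ c))

multisum-scale : ∀ {n} (d : Fin n → ℕ) s w x (F : (Fin n → ℤ) → ℤ) →
  multisum d s w (λ c → x * F c) ≡ x * multisum d s w F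
multisum-scale {zero}  d s w x F = refl
multisum-scale {suc n} d s w x F = begin
  (sum λ a → w zero a * rest (λ c → x * F (s zero a ◂ c)))
    ≡⟨ ∑.sum-cong-≗ (λ a → trans
         (cong (w zero a *_) (multisum-scale (d ∘ suc) s⁺ w⁺ x λ c → F (s zero a ◂ c)))
         (x∙yz≈y∙xz (w zero a) x (rest λ c → F (s zero a ◂ c)))) ⟩
  (sum λ a → x * (w zero a * rest (λ c → F (s zero a ◂ c))))
    ≡⟨ ∑.*-distribˡ-sum x (λ a → w zero a * rest (λ c → F (s zero a ◂ c))) ⟨
  x * multisum d s w F ∎
  where
  open ≡-Reasoning
  s⁺ w⁺ : ∀ i → Fin (suc (d (suc i))) → ℤ
  s⁺ i = s (suc i)
  w⁺ i = w (suc i)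
  rest : ((Fin n → ℤ) → ℤ) → ℤ
  rest = multisum (d ∘ suc) s⁺ w⁺

multisum-+ : ∀ {n} (d : Fin n → ℕ) s w (F G : (Fin n → ℤ) → ℤ) →
  multisum d s w (λ c → F c + G c) ≡ multisum d s w F + multisum d s w G
multisum-+ {zero}  d s w F G = refl
multisum-+ {suc n} d s w F G = begin
  (sum λ a → w zero a * rest (λ c → F (s zero a ◂ c) + G (s zero a ◂ c)))
    ≡⟨ ∑.sum-cong-≗ (λ a → trans
         (cong (w zero a *_) (multisum-+ (d ∘ suc) s⁺ w⁺ (λ c → F (s zero a ◂ c)) (λ c → G (s zero a ◂ c))))
         (ℤ.*-distribˡ-+ (w zero a) (rest λ c → F (s zero a ◂ c)) (rest λ c → G (s zero a ◂ c)))) ⟩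
  (sum λ a → w zero a * rest (λ c → F (s zero a ◂ c)) + w zero a * rest (λ c → G (s zero a ◂ c)))
    ≡⟨ ∑.∑-distrib-+ (λ a → w zero a * rest (λ c → F (s zero a ◂ c))) (λ a → w zero a * rest (λ c → G (s zero a ◂ c))) ⟩
  multisum d s w F + multisum d s w G ∎
  where
  open ≡-Reasoning
  s⁺ w⁺ : ∀ i → Fin (suc (d (suc i))) → ℤ
  s⁺ i = s (suc i)
  w⁺ i = w (suc i)
  rest : ((Fin n → ℤ) → ℤ) → ℤ
  rest = multisum (d ∘ suc) s⁺ w⁺

-- A nonzero sum has a nonzero term; this is where an actual choice of colours is extracted from the
-- algebra.
multisum≢0 : ∀ {n} (d : Fin n → ℕ) s w (F : (Fin n → ℤ) → ℤ) → multisum d s w F ≢ 0ℤ →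
  Σ[ c ∈ (Fin n → ℤ) ] F c ≢ 0ℤ × (∀ i → ∃[ a ] c i ≡ s i a)
multisum≢0 {zero}  d s w F Σ≢0 = (λ ()) , Σ≢0 , λ ()
multisum≢0 {suc n} d s w F Σ≢0 with sum≢0⇒term≢0
  (λ a → w zero a * multisum (d ∘ suc) (λ i → s (suc i)) (λ i → w (suc i)) (λ c → F (s zero a ◂ c))) Σ≢0
... | a , wa*≢0 with multisum≢0 (d ∘ suc) (λ i → s (suc i)) (λ i → w (suc i)) (λ c → F (s zero a ◂ c))
                       (λ eq → wa*≢0 (trans (cong (w zero a *_) eq) (ℤ.*-zeroʳ (w zero a))))
...   | c , Fc≢0 , c∈s = (s zero a ◂ c) , Fc≢0 , λ { zero → a , refl ; (suc i) → c∈s i }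

monomial : ∀ {n} → (Fin n → ℕ) → (Fin n → ℤ) → ℤ
monomial e c = product λ i → c i ^ e i

monomial-suc : ∀ {n} (e : Fin n → ℕ) c j → c j * monomial e c ≡ monomial (updateAt e j suc) c
monomial-suc e c zero    = sym (ℤ.*-assoc (c zero) (c zero ^ e zero) _)
monomial-suc e c (suc j) =
  trans (x∙yz≈y∙xz (c (suc j)) (c zero ^ e zero) _) (cong (c zero ^ e zero *_) (monomial-suc (e ∘ suc) (c ∘ suc) j))

-- A monomial separates the variables, so the tensor product of functionals factors into one moment
-- per variable.
multisum-monomial : ∀ {n} (d : Fin n → ℕ) s w (e : Fin n → ℕ) →
  multisum d s w (monomial e) ≡ product λ i → moment (w i) (s i) (e i)
multisum-monomial {zero}  d s w e = refl
multisum-monomial {suc n} d s w e = begin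
  (sum λ a → w zero a * rest (λ c → s zero a ^ e zero * monomial (e ∘ suc) c))
    ≡⟨ ∑.sum-cong-≗ (λ a → trans
         (cong (w zero a *_) (trans
           (multisum-scale (d ∘ suc) s⁺ w⁺ (s zero a ^ e zero) (monomial (e ∘ suc)))
           (cong (s zero a ^ e zero *_) (multisum-monomial (d ∘ suc) s⁺ w⁺ (e ∘ suc)))))
         (sym (ℤ.*-assoc (w zero a) (s zero a ^ e zero) tail))) ⟩
  (sum λ a → w zero a * s zero a ^ e zero * tail)
    ≡⟨ ∑.*-distribʳ-sum tail (λ a → w zero a * s zero a ^ e zero) ⟨
  moment (w zero) (s zero) (e zero) * tail ∎
  where
  open ≡-Reasoning
  s⁺ w⁺ : ∀ i → Fin (suc (d (suc i))) → ℤ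
  s⁺ i = s (suc i)
  w⁺ i = w (suc i)
  rest : ((Fin n → ℤ) → ℤ) → ℤ
  rest = multisum (d ∘ suc) s⁺ w⁺
  tail : ℤ
  tail = product λ i → moment (w⁺ i) (s⁺ i) (e (suc i))

-- Signed sums over sublists

module _ {A : Set} where

  sumSublists : (List A → ℤ) → List A → ℤ
  sumSublists F []       = F []
  sumSublists F (e ∷ es) = sumSublists (F ∘ (e ∷_)) es + sumSublists F es

  -- Equality is demanded only on sublists of `es`, because discarding a non-circulation later
  -- requires its indegrees to be bounded by those of `es`.
  sumSublists-cong : ∀ {F F′ : List A → ℤ} es → (∀ {R} → R ⊆ es → F R ≡ F′ R) →
    sumSublists F es ≡ sumSublists F′ es
  sumSublists-cong []       F≗F′ = F≗F′ []
  sumSublists-cong (e ∷ es) F≗F′ =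
    cong₂ _+_ (sumSublists-cong es (λ R⊆es → F≗F′ (refl ∷ R⊆es))) (sumSublists-cong es (λ R⊆es → F≗F′ (e ∷ʳ R⊆es)))

  sumSublists-scale : ∀ x (F : List A → ℤ) es → sumSublists (λ R → x * F R) es ≡ x * sumSublists F es
  sumSublists-scale x F []       = refl
  sumSublists-scale x F (e ∷ es) =
    trans (cong₂ _+_ (sumSublists-scale x (F ∘ (e ∷_)) es) (sumSublists-scale x F es)) (sym (ℤ.*-distribˡ-+ x _ _))

  sumList : (List A → ℤ) → List (List A) → ℤ
  sumList F = foldr (λ R → F R +_) 0ℤ

  sumList-++ : ∀ F Rs Rs′ → sumList F (Rs ++ Rs′) ≡ sumList F Rs + sumList F Rs′
  sumList-++ F []       Rs′ = sym (ℤ.+-identityˡ _)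
  sumList-++ F (R ∷ Rs) Rs′ = trans (cong (F R +_) (sumList-++ F Rs Rs′)) (sym (ℤ.+-assoc (F R) _ _))

  sumList-map : ∀ F e Rs → sumList F (map (e ∷_) Rs) ≡ sumList (F ∘ (e ∷_)) Rs
  sumList-map F e []       = refl
  sumList-map F e (R ∷ Rs) = cong (F (e ∷ R) +_) (sumList-map F e Rs)

  sumSublists≡sumList : ∀ F es → sumSublists F es ≡ sumList F (sublists es)
  sumSublists≡sumList F []       = sym (ℤ.+-identityʳ _)
  sumSublists≡sumList F (e ∷ es) = begin
    sumSublists (F ∘ (e ∷_)) es + sumSublists F es
      ≡⟨ cong₂ _+_ (sumSublists≡sumList (F ∘ (e ∷_)) es) (sumSublists≡sumList F es) ⟩
    sumList (F ∘ (e ∷_)) (sublists es) + sumList F (sublists es)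
      ≡⟨ cong (_+ sumList F (sublists es)) (sumList-map F e (sublists es)) ⟨
    sumList F (map (e ∷_) (sublists es)) + sumList F (sublists es)
      ≡⟨ sumList-++ F (map (e ∷_) (sublists es)) (sublists es) ⟨
    sumList F (sublists (e ∷ es)) ∎
    where open ≡-Reasoning

  sign : List A → ℤ
  sign R = -1ℤ ^ length R

-1^even : ∀ {n} → 2 ∣ n → -1ℤ ^ n ≡ 1ℤ
-1^even (divides q refl) = go q
  where
  go : ∀ q → -1ℤ ^ (q ℕ.* 2) ≡ 1ℤ
  go zero    = refl
  go (suc q) rewrite go q = refl

-1^odd : ∀ n → ¬ (2 ∣ n) → -1ℤ ^ n ≡ -1ℤ
-1^odd zero          ¬2∣n = contradiction (divides 0 refl) ¬2∣n
-1^odd (suc zero)    ¬2∣n = refl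
-1^odd (suc (suc n)) ¬2∣n
  rewrite -1^odd n (λ { (divides q refl) → ¬2∣n (divides (suc q) refl) }) = refl

updateAt-≡ : ∀ {n} (x : Fin n → ℕ) j i → updateAt x j suc i ≡ (if does (j Fin.≟ i) then 1 else 0) ℕ.+ x i
updateAt-≡ x j i with j Fin.≟ i
... | yes refl = updateAt-updates i x
... | no  j≢i  = updateAt-minimal i j x (j≢i ∘ sym)

sum-updateAt : ∀ {n} (x : Fin n → ℕ) j → ∑ℕ.sum (updateAt x j suc) ≡ suc (∑ℕ.sum x)
sum-updateAt x zero    = refl
sum-updateAt x (suc j) = trans (cong (x zero ℕ.+_) (sum-updateAt (x ∘ suc) j)) (ℕ.+-suc _ _)

sum-mono : ∀ {n} (f g : Fin n → ℕ) → (∀ i → f i ≤ g i) → ∑ℕ.sum f ≤ ∑ℕ.sum g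
sum-mono {zero}  f g f≤g = z≤n
sum-mono {suc n} f g f≤g = ℕ.+-mono-≤ (f≤g zero) (sum-mono (f ∘ suc) (g ∘ suc) (f≤g ∘ suc))

-- Equal totals leave no room for strict inequality at any index. Applied to degrees, this turns
-- one-sided inequalities into balance at every vertex.
sum-mono-≡ : ∀ {n} (f g : Fin n → ℕ) → (∀ i → f i ≤ g i) → ∑ℕ.sum f ≡ ∑ℕ.sum g → ∀ i → f i ≡ g i
sum-mono-≡ {suc n} f g f≤g ∑f≡∑g = λ where
    zero    → head≡
    (suc i) → sum-mono-≡ (f ∘ suc) (g ∘ suc) (f≤g ∘ suc) tail≡ i
  where
  head≡ : f zero ≡ g zero
  head≡ = ℕ.≤-antisym (f≤g zero) (ℕ.+-cancelʳ-≤ (∑ℕ.sum (f ∘ suc)) _ _ (ℕ.≤-trans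
    (ℕ.+-monoʳ-≤ (g zero) (sum-mono (f ∘ suc) (g ∘ suc) (f≤g ∘ suc))) (ℕ.≤-reflexive (sym ∑f≡∑g))))
  tail≡ : ∑ℕ.sum (f ∘ suc) ≡ ∑ℕ.sum (g ∘ suc)
  tail≡ = ℕ.+-cancelˡ-≡ (f zero) _ _ (trans ∑f≡∑g (cong (ℕ._+ ∑ℕ.sum (g ∘ suc)) (sym head≡)))

-- Degrees and the expansion of the arc product

module Circulations (G : FiniteSimpleGraph) where
  open FiniteSimpleGraph G renaming (V to Vertex)
  private
    Arc = Vertex × Vertex
    to  = Inverse.to index

  vertex-to : ∀ v → vertex (to v) ≡ v
  vertex-to = Inverse.strictlyInverseʳ index

  to-vertex : ∀ i → to (vertex i) ≡ i
  to-vertex = Inverse.strictlyInverseˡ index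

  ∈-vertices : ∀ v → v ∈ vertices
  ∈-vertices v = subst (_∈ vertices) (vertex-to v) (∈-map⁺ vertex (∈-allFin (to v)))

  -- Treats both degrees at once: with `proj₂` and `proj₁` it unfolds to `indegree G` and
  -- `outdegree G`.
  degree : (Arc → Vertex) → List Arc → Vertex → ℕ
  degree end es v = length (filter (λ e → end e ≟ᵥ v) es)

  degree-∷ : ∀ end e es i →
    degree end (e ∷ es) (vertex i) ≡ updateAt (degree end es ∘ vertex) (to (end e)) suc i
  degree-∷ end e es i with end e ≟ᵥ vertex i
  ... | yes e≡i = begin
    degree end (e ∷ es) (vertex i)
      ≡⟨ cong length (filter-accept (λ e → end e ≟ᵥ vertex i) e≡i) ⟩
    suc (degree end es (vertex i))
      ≡⟨ updateAt-updates i (degree end es ∘ vertex) ⟨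
    updateAt (degree end es ∘ vertex) i suc i
      ≡⟨ cong (λ j → updateAt (degree end es ∘ vertex) j suc i) (trans (cong to e≡i) (to-vertex i)) ⟨
    updateAt (degree end es ∘ vertex) (to (end e)) suc i ∎
    where open ≡-Reasoning
  ... | no  e≢i = trans (cong length (filter-reject (λ e → end e ≟ᵥ vertex i) e≢i))
    (sym (updateAt-minimal i (to (end e)) (degree end es ∘ vertex)
      λ i≡e → e≢i (trans (sym (vertex-to (end e))) (cong vertex (sym i≡e)))))

  degree-mono : ∀ end {R es} → R ⊆ es → ∀ v → degree end R v ≤ degree end es v
  degree-mono end R⊆es v = Sublist.length-mono-≤ (Sublist.filter⁺ _ _ (λ { refl p → p }) R⊆es)

  sum-degree : ∀ end es → ∑ℕ.sum (degree end es ∘ vertex) ≡ length es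
  sum-degree end []       = ∑ℕ.sum-replicate-zero size
  sum-degree end (e ∷ es) = begin
    ∑ℕ.sum (degree end (e ∷ es) ∘ vertex)                            ≡⟨ ∑ℕ.sum-cong-≗ (degree-∷ end e es) ⟩
    ∑ℕ.sum (updateAt (degree end es ∘ vertex) (to (end e)) suc)      ≡⟨ sum-updateAt (degree end es ∘ vertex) (to (end e)) ⟩
    suc (∑ℕ.sum (degree end es ∘ vertex))                            ≡⟨ cong suc (sum-degree end es) ⟩
    suc (length es)                                                  ∎
    where open ≡-Reasoning

  -- Indegrees and outdegrees both sum to the number of arcs, so if no indegree exceeded its
  -- outdegree they would agree everywhere.
  unbalanced : ∀ R → ¬ IsCirculation G R →
    ∃[ i ] outdegree G R (vertex i) < indegree G R (vertex i)
  unbalanced R ¬circ with Fin.any? (λ i → outdegree G R (vertex i) ℕ.<? indegree G R (vertex i))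
  ... | yes found = found
  ... | no  none  = contradiction circ ¬circ
    where
    balanced : ∀ i → indegree G R (vertex i) ≡ outdegree G R (vertex i)
    balanced = sum-mono-≡ _ _ (λ i → ℕ.≮⇒≥ (λ lt → none (i , lt)))
      (trans (sum-degree proj₂ R) (sym (sum-degree proj₁ R)))
    circ : IsCirculation G R
    circ v = subst (λ v → indegree G R v ≡ outdegree G R v) (vertex-to v) (balanced (to v))

  difference : Arc → (Fin size → ℤ) → ℤ
  difference (u , v) c = c (to v) - c (to u)

  arcProduct : List Arc → (Fin size → ℤ) → ℤ
  arcProduct es c = foldr (λ e p → difference e c * p) 1ℤ es

  arcProduct-factor : ∀ {e es} → e ∈ es → ∀ c → arcProduct es c ≢ 0ℤ → difference e c ≢ 0ℤ
  arcProduct-factor {es = es} (here refl) c p≢0 eq = p≢0 (cong (_* _) eq)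
  arcProduct-factor {es = e ∷ es} (there e∈es) c p≢0 =
    arcProduct-factor e∈es c λ eq → p≢0 (trans (cong (difference e c *_) eq) (ℤ.*-zeroʳ (difference e c)))

  -- The exponents of the monomial obtained from the factor x of the arc product by
  -- choosing the tail in the arcs of R and the head in the other arcs of es.
  exponent : (Fin size → ℕ) → List Arc → List Arc → Fin size → ℕ
  exponent x es R i = (x i ℕ.+ indegree G es (vertex i) ℕ.+ outdegree G R (vertex i)) ∸ indegree G R (vertex i)

  private
    at : Vertex → Fin size → ℕ
    at v i = if does (to v Fin.≟ i) then 1 else 0

    degree-at : ∀ end e es i → degree end (e ∷ es) (vertex i) ≡ at (end e) i ℕ.+ degree end es (vertex i)
    degree-at end e es i = trans (degree-∷ end e es i) (updateAt-≡ (degree end es ∘ vertex) (to (end e)) i)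

  -- Choosing the head of the first arc moves one unit from the indegree of the arc list into the
  -- monomial `x`.
  exponent-head : ∀ x u v es R i →
    exponent x ((u , v) ∷ es) R i ≡ exponent (updateAt x (to v) suc) es R i
  exponent-head x u v es R i = cong (λ y → (y ℕ.+ outdegree G R (vertex i)) ∸ indegree G R (vertex i)) (begin
    x i ℕ.+ indegree G ((u , v) ∷ es) (vertex i)        ≡⟨ cong (x i ℕ.+_) (degree-at proj₂ (u , v) es i) ⟩
    x i ℕ.+ (at v i ℕ.+ indegree G es (vertex i))       ≡⟨ shift (x i) (at v i) _ ⟩
    at v i ℕ.+ x i ℕ.+ indegree G es (vertex i)         ≡⟨ cong (ℕ._+ indegree G es (vertex i)) (updateAt-≡ x (to v) i) ⟨
    updateAt x (to v) suc i ℕ.+ indegree G es (vertex i) ∎)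
    where
    open ≡-Reasoning
    shift : ∀ a b c → a ℕ.+ (b ℕ.+ c) ≡ b ℕ.+ a ℕ.+ c
    shift = solveℕ-∀

  -- The arc now counts in both lists: its two contributions at the head cancel, and the unit of
  -- outdegree at the tail moves into `x`.
  exponent-tail : ∀ x u v es R i →
    exponent x ((u , v) ∷ es) ((u , v) ∷ R) i ≡ exponent (updateAt x (to u) suc) es R i
  exponent-tail x u v es R i = begin
    (x i ℕ.+ indegree G (e ∷ es) (vertex i) ℕ.+ outdegree G (e ∷ R) (vertex i)) ∸ indegree G (e ∷ R) (vertex i)
      ≡⟨ cong₂ _∸_ (cong₂ (λ y z → x i ℕ.+ y ℕ.+ z) (degree-at proj₂ e es i) (degree-at proj₁ e R i)) (degree-at proj₂ e R i) ⟩
    (x i ℕ.+ (at v i ℕ.+ indegree G es (vertex i)) ℕ.+ (at u i ℕ.+ outdegree G R (vertex i))) ∸ (at v i ℕ.+ indegree G R (vertex i))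
      ≡⟨ cong (_∸ (at v i ℕ.+ indegree G R (vertex i))) (shift (x i) (at v i) _ (at u i) _) ⟩
    (at v i ℕ.+ (at u i ℕ.+ x i ℕ.+ indegree G es (vertex i) ℕ.+ outdegree G R (vertex i))) ∸ (at v i ℕ.+ indegree G R (vertex i))
      ≡⟨ ℕ.[m+n]∸[m+o]≡n∸o (at v i) _ _ ⟩
    (at u i ℕ.+ x i ℕ.+ indegree G es (vertex i) ℕ.+ outdegree G R (vertex i)) ∸ indegree G R (vertex i)
      ≡⟨ cong (λ y → (y ℕ.+ indegree G es (vertex i) ℕ.+ outdegree G R (vertex i)) ∸ indegree G R (vertex i)) (updateAt-≡ x (to u) i) ⟨
    exponent (updateAt x (to u) suc) es R i ∎
    where
    open ≡-Reasoning
    e = u , v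
    shift : ∀ a b c d e → a ℕ.+ (b ℕ.+ c) ℕ.+ (d ℕ.+ e) ≡ b ℕ.+ (d ℕ.+ a ℕ.+ c ℕ.+ e)
    shift = solveℕ-∀

  module _ (d : Fin size → ℕ) (s w : ∀ i → Fin (suc (d i)) → ℤ) where

    momentProduct : (Fin size → ℕ) → ℤ
    momentProduct x = product λ i → moment (w i) (s i) (x i)

    momentProduct-cong : ∀ {x y} → x ≗ y → momentProduct x ≡ momentProduct y
    momentProduct-cong x≗y = ∏.sum-cong-≗ λ i → cong (moment (w i) (s i)) (x≗y i)

    -- Each factor offers its head with sign plus or its tail with sign minus; `R` collects the arcs
    -- whose tail is chosen. The monomial `x` accumulates the choices already made, which makes the
    -- induction go through.
    expansion : ∀ es x → multisum d s w (λ c → arcProduct es c * monomial x c) ≡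
      sumSublists (λ R → sign R * momentProduct (exponent x es R)) es
    expansion [] x = begin
      multisum d s w (λ c → 1ℤ * monomial x c)   ≡⟨ multisum-scale d s w 1ℤ (monomial x) ⟩
      1ℤ * multisum d s w (monomial x)           ≡⟨ cong (1ℤ *_) (multisum-monomial d s w x) ⟩
      1ℤ * momentProduct x                       ≡⟨ cong (1ℤ *_) (∏.sum-cong-≗ λ i → cong (moment (w i) (s i)) (clean (x i))) ⟩
      1ℤ * momentProduct (exponent x [] [])      ∎
      where
      open ≡-Reasoning
      clean : ∀ a → a ≡ a ℕ.+ 0 ℕ.+ 0
      clean = solveℕ-∀
    expansion (e@(u , v) ∷ es) x = begin
      multisum d s w (λ c → (c (to v) - c (to u)) * arcProduct es c * monomial x c)
        ≡⟨ multisum-cong d s w (λ c → split (c (to v)) (c (to u)) (arcProduct es c) (monomial x c)) ⟩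
      multisum d s w (λ c → chosen v c + -1ℤ * chosen u c)
        ≡⟨ multisum-+ d s w (chosen v) (λ c → -1ℤ * chosen u c) ⟩
      multisum d s w (chosen v) + multisum d s w (λ c → -1ℤ * chosen u c)
        ≡⟨ cong (multisum d s w (chosen v) +_) (multisum-scale d s w -1ℤ (chosen u)) ⟩
      multisum d s w (chosen v) + -1ℤ * multisum d s w (chosen u)
        ≡⟨ cong₂ (λ a b → a + -1ℤ * b) (absorb v) (absorb u) ⟩
      sumSublists (λ R → sign R * momentProduct (exponent (updateAt x (to v) suc) es R)) es
        + -1ℤ * sumSublists (λ R → sign R * momentProduct (exponent (updateAt x (to u) suc) es R)) es
        ≡⟨ cong₂ _+_
             (sumSublists-cong es λ {R} _ → cong (sign R *_) (momentProduct-cong (exponent-head x u v es R)))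
             tail-terms ⟨
      sumSublists term es + sumSublists (term ∘ (e ∷_)) es
        ≡⟨ ℤ.+-comm (sumSublists term es) (sumSublists (term ∘ (e ∷_)) es) ⟩
      sumSublists term (e ∷ es) ∎
      where
      open ≡-Reasoning
      chosen : Vertex → (Fin size → ℤ) → ℤ
      chosen z c = arcProduct es c * (c (to z) * monomial x c)
      term : List Arc → ℤ
      term R = sign R * momentProduct (exponent x (e ∷ es) R)
      split : ∀ a b p q → (a - b) * p * q ≡ p * (a * q) + -1ℤ * (p * (b * q))
      split = solve-∀
      absorb : ∀ z → multisum d s w (chosen z) ≡
        sumSublists (λ R → sign R * momentProduct (exponent (updateAt x (to z) suc) es R)) es
      absorb z = trans (multisum-cong d s w λ c → cong (arcProduct es c *_) (monomial-suc x c (to z)))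
        (expansion es (updateAt x (to z) suc))
      tail-terms : sumSublists (term ∘ (e ∷_)) es ≡
        -1ℤ * sumSublists (λ R → sign R * momentProduct (exponent (updateAt x (to u) suc) es R)) es
      tail-terms = trans
        (sumSublists-cong es λ {R} _ → trans
          (cong (sign (e ∷ R) *_) (momentProduct-cong (exponent-tail x u v es R)))
          (ℤ.*-assoc -1ℤ (sign R) (momentProduct (exponent (updateAt x (to u) suc) es R))))
        (sumSublists-scale -1ℤ (λ R → sign R * momentProduct (exponent (updateAt x (to u) suc) es R)) es)

-- The Alon–Tarsi theorem

lookup-injective : ∀ {A : Set} {xs : List A} → Unique xs → ∀ i j → lookup xs i ≡ lookup xs j → i ≡ j
lookup-injective (x∉xs ∷ _) zero    zero    _  = refl
lookup-injective (x∉xs ∷ _) zero    (suc j) eq = contradiction eq (All.lookup x∉xs (∈-lookup j))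
lookup-injective (x∉xs ∷ _) (suc i) zero    eq = contradiction (sym eq) (All.lookup x∉xs (∈-lookup i))
lookup-injective (_ ∷ xs!)  (suc i) (suc j) eq = cong suc (lookup-injective xs! i j eq)

sumSigns : ∀ {A : Set} {Q : List A → Set} 
  (Q? : U.Decidable Q) (even? : U.Decidable λ R → 2 ∣ length R) Rs →
  sumList (λ R → if does (Q? R) then sign R else 0ℤ) Rs ≡
    pos (length (filter even? (filter Q? Rs))) -
    pos (length (filter (¬? ∘ even?) (filter Q? Rs)))
sumSigns Q? even? [] = refl
sumSigns Q? even? (R ∷ Rs) with Q? R
... | no  _ = trans (ℤ.+-identityˡ _) (sumSigns Q? even? Rs)
... | yes _ with even? R
...   | yes 2∣R rewrite -1^even 2∣R | sumSigns Q? even? Rs =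
  sym (ℤ.+-assoc 1ℤ (pos evens) (- pos odds))
  where
  evens = length (filter even? (filter Q? Rs))
  odds  = length (filter (¬? ∘ even?) (filter Q? Rs))
...   | no ¬2∣R rewrite -1^odd (length R) ¬2∣R | sumSigns Q? even? Rs = move (pos evens) (pos odds)
  where
  evens = length (filter even? (filter Q? Rs))
  odds  = length (filter (¬? ∘ even?) (filter Q? Rs))
  move : ∀ x y → -1ℤ + (x - y) ≡ x - (1ℤ + y)
  move = solve-∀

module _ (G : FiniteSimpleGraph) where
  open FiniteSimpleGraph G renaming (V to Vertex)
  open Circulations G
  private
    Arc = Vertex × Vertex
    to  = Inverse.to index

  circulationSign : U.Decidable (IsCirculation G) → List Arc → ℤ
  circulationSign circ? R = if does (circ? R) then sign R else 0ℤ

  module _ (es : List Arc) where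
    private
      d : Fin size → ℕ
      d i = indegree G es (vertex i)

    -- At every vertex the tails gained from `R` compensate the heads given up.
    exponent-circulation : ∀ {R} → IsCirculation G R → ∀ i → exponent (λ _ → 0) es R i ≡ d i
    exponent-circulation {R} circ i = trans
      (cong (λ y → (d i ℕ.+ y) ∸ indegree G R (vertex i)) (sym (circ (vertex i))))
      (ℕ.m+n∸n≡m (d i) (indegree G R (vertex i)))

    -- At a vertex where `R` has more arcs in than out, more heads are given up than tails are
    -- gained.
    exponent-deficient : ∀ {R} → R ⊆ es → ¬ IsCirculation G R → ∃[ i ] exponent (λ _ → 0) es R i < d i
    exponent-deficient {R} R⊆es ¬circ with unbalanced R ¬circ
    ... | i , out<in = i , (begin-strict
      -- Since `R ⊆ es` bounds `ind` by `d i`, the truncated subtraction is a genuine one and stays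
      -- strictly monotone.
      (d i ℕ.+ out) ∸ ind  <⟨ ℕ.∸-monoˡ-< (ℕ.+-monoʳ-< (d i) out<in) (ℕ.≤-trans ind≤d (ℕ.m≤m+n (d i) out)) ⟩
      (d i ℕ.+ ind) ∸ ind  ≡⟨ ℕ.m+n∸n≡m (d i) ind ⟩
      d i                  ∎)
      where
      open ℕ.≤-Reasoning
      ind = indegree G R (vertex i)
      out = outdegree G R (vertex i)
      ind≤d : ind ≤ d i
      ind≤d = degree-mono proj₂ R⊆es (vertex i)

    module _ (circ? : U.Decidable (IsCirculation G)) (s w : ∀ i → Fin (suc (d i)) → ℤ)
             (kills : ∀ i j → j < d i → moment (w i) (s i) j ≡ 0ℤ)
             (leads : ∀ i → moment (w i) (s i) (d i) ≢ 0ℤ) where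

      leading : ℤ
      leading = momentProduct d s w d

      -- Only circulations survive the expansion: each has exponents `d` and contributes `leading`,
      -- whereas any other `R` has an exponent below `d i` at some `i`, whose moment is zero.
      multisum-arcProduct : multisum d s w (arcProduct es) ≡ leading * sumSublists (circulationSign circ?) es
      multisum-arcProduct = begin
        multisum d s w (arcProduct es)
          ≡⟨ multisum-cong d s w (λ c → trans (sym (ℤ.*-identityʳ (arcProduct es c)))
               (cong (arcProduct es c *_) (sym (∏.sum-replicate-zero size)))) ⟩
        multisum d s w (λ c → arcProduct es c * monomial (λ _ → 0) c)
          ≡⟨ expansion d s w es (λ _ → 0) ⟩
        sumSublists (λ R → sign R * momentProduct d s w (exponent (λ _ → 0) es R)) es
          ≡⟨ sumSublists-cong es term ⟩
        sumSublists (λ R → leading * circulationSign circ? R) es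
          ≡⟨ sumSublists-scale leading (circulationSign circ?) es ⟩
        leading * sumSublists (circulationSign circ?) es ∎
        where
        open ≡-Reasoning
        term : ∀ {R} → R ⊆ es →
          sign R * momentProduct d s w (exponent (λ _ → 0) es R) ≡ leading * circulationSign circ? R
        term {R} R⊆es with circ? R
        ... | yes circ = trans (ℤ.*-comm (sign R) _)
          (cong (_* sign R) (momentProduct-cong d s w (exponent-circulation {R} circ)))
        ... | no ¬circ with exponent-deficient {R} R⊆es ¬circ
        ...   | i , e<d = trans
          (cong (sign R *_) (product-zero (λ i → moment (w i) (s i) (exponent (λ _ → 0) es R i)) i (kills i _ e<d)))
          (trans (ℤ.*-zeroʳ (sign R)) (sym (ℤ.*-zeroʳ leading)))

    module _ (circ? : U.Decidable (IsCirculation G)) (even? : U.Decidable λ (R : List Arc) → 2 ∣ length R) where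

      signs≢0 : length (filter even? (filter circ? (sublists es))) ≢ length (filter (¬? ∘ even?) (filter circ? (sublists es))) →
        sumSublists (circulationSign circ?) es ≢ 0ℤ
      signs≢0 EE≢EO eq = EE≢EO (ℤ.+-injective (ℤ.i-j≡0⇒i≡j _ _ (trans
        (sym (sumSigns circ? even? (sublists es)))
        (trans (sym (sumSublists≡sumList (circulationSign circ?) es)) eq))))

    module _ (circ? : U.Decidable (IsCirculation G)) (signs≢0 : sumSublists (circulationSign circ?) es ≢ 0ℤ)
             (L : Vertex → List ℕ) (L-unique : ∀ v → Unique (L v)) (d<L : ∀ i → suc (d i) ≤ length (L (vertex i))) where
      private
        -- Keeps the first `suc (d i)` colours of the list, the number of nodes of a divided
        -- difference of order `d i`.
        available : ∀ i → Fin (suc (d i)) → ℕ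
        available i a = lookup (L (vertex i)) (inject≤ a (d<L i))

        s : ∀ i → Fin (suc (d i)) → ℤ
        s i a = pos (available i a)

        s-injective : ∀ i → Injective _≡_ _≡_ (s i)
        s-injective i eq = Fin.inject≤-injective (d<L i) (d<L i) _ _
          (lookup-injective (L-unique (vertex i)) _ _ (ℤ.+-injective eq))

        W : ∀ i → Σ[ w ∈ (Fin (suc (d i)) → ℤ) ] (∀ j → j < d i → moment w (s i) j ≡ 0ℤ) × moment w (s i) (d i) ≢ 0ℤ
        W i = weights (d i) (s i) (s-injective i)

        w : ∀ i → Fin (suc (d i)) → ℤ
        w i = proj₁ (W i)

        kills : ∀ i j → j < d i → moment (w i) (s i) j ≡ 0ℤ
        kills i = proj₁ (proj₂ (W i))

        leads : ∀ i → moment (w i) (s i) (d i) ≢ 0ℤ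
        leads i = proj₂ (proj₂ (W i))

        found : Σ[ c ∈ (Fin size → ℤ) ] arcProduct es c ≢ 0ℤ × (∀ i → ∃[ a ] c i ≡ s i a)
        found = multisum≢0 d s w (arcProduct es) λ eq →
          *≢0 (product≢0 (λ i → moment (w i) (s i) (d i)) leads) signs≢0
            (trans (sym (multisum-arcProduct circ? s w kills leads)) eq)

        c : Fin size → ℤ
        c = proj₁ found

        choice : ∀ i → ∃[ a ] c i ≡ s i a
        choice = proj₂ (proj₂ found)

        colour : Vertex → ℕ
        colour v = available (to v) (proj₁ (choice (to v)))

        colour∈L : ∀ v → colour v ∈ L v
        colour∈L v = subst (λ v′ → colour v ∈ L v′) (vertex-to v) (∈-lookup _)

        colour-proper : ∀ u v → (u , v) ∈ es → colour u ≢ colour v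
        colour-proper u v uv∈es eq = arcProduct-factor uv∈es c (proj₁ (proj₂ found))
          (ℤ.i≡j⇒i-j≡0 (trans (proj₂ (choice (to v))) (trans (cong pos (sym eq)) (sym (proj₂ (choice (to u)))))))

      listColouring : Σ[ f ∈ (Vertex → ℕ) ] (∀ u v → (u , v) ∈ es → f u ≢ f v) × (∀ v → f v ∈ L v)
      listColouring = colour , colour-proper , colour∈L

  choosable : ∀ es → (∀ {u v} → u ~ v → (u , v) ∈ es ⊎ (v , u) ∈ es) →
    (circ? : U.Decidable (IsCirculation G)) → sumSublists (circulationSign circ?) es ≢ 0ℤ →
    ∀ {k} → (∀ v → indegree G es v < k) → Choosable G k
  choosable es covers circ? signs≢0 d<k L L-unique k≤L = proper
    (listColouring es circ? signs≢0 L L-unique (λ i → ℕ.≤-trans (d<k (vertex i)) (k≤L (vertex i))))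
    where
    proper : Σ[ f ∈ (Vertex → ℕ) ] (∀ u v → (u , v) ∈ es → f u ≢ f v) × (∀ v → f v ∈ L v) →
      Σ[ f ∈ (Vertex → ℕ) ] IsProper G f × (∀ v → f v ∈ L v)
    proper (f , f-proper , f∈L) = f ,
      (λ {u} {v} u~v → [ f-proper u v , (λ vu∈es → f-proper v u vu∈es ∘ sym) ]′ (covers u~v)) ,
      f∈L

  module _ (D : Orientation G) where
    open Orientation D

    ∈-arcs⁺ : ∀ {u v} → u ⇾ v → (u , v) ∈ arcs G D
    ∈-arcs⁺ {u} {v} = ∈-filter⁺ (λ (u , v) → u ⇾? v) (∈-cartesianProduct⁺ (∈-vertices u) (∈-vertices v))

    indegree≤maxIndegree : ∀ v → indegree G (arcs G D) v ≤ maxIndegree G D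
    indegree≤maxIndegree v =
      All.lookup (xs≤max 0 (map (indegree G (arcs G D)) vertices)) (∈-map⁺ (indegree G (arcs G D)) (∈-vertices v))

  alonTarsi : ∀ {k} → HasAlonTarsiOrientation G k → Choosable G k
  alonTarsi (D , refl , EE≢EO) = choosable (arcs G D)
    (λ u~v → [ (λ u⇾v → inj₁ (∈-arcs⁺ D u⇾v)) , (λ v⇾u → inj₂ (∈-arcs⁺ D v⇾u)) ]′ (Orientation.total D u~v))
    (isCirculation? G)
    (signs≢0 (arcs G D) (isCirculation? G) (λ R → 2 ∣? length R) EE≢EO)
    (λ v → s≤s (indegree≤maxIndegree D v))

-- Parities of numbers of sublists

module _ {A : Set} where

  xorSublists : (List A → Bool) → List A → Bool
  xorSublists p []       = p []
  xorSublists p (e ∷ es) = xorSublists (p ∘ (e ∷_)) es xor xorSublists p es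

  xorSublists-cong : ∀ {p q : List A → Bool} → p ≗ q → ∀ es → xorSublists p es ≡ xorSublists q es
  xorSublists-cong p≗q []       = p≗q []
  xorSublists-cong p≗q (e ∷ es) = cong₂ _xor_ (xorSublists-cong (p≗q ∘ (e ∷_)) es) (xorSublists-cong p≗q es)

odd : ℕ → Bool
odd zero    = false
odd (suc n) = not (odd n)

odd-+ : ∀ m n → odd (m ℕ.+ n) ≡ odd m xor odd n
odd-+ zero    n = refl
odd-+ (suc m) n = trans (cong not (odd-+ m n)) (Bool.not-distribˡ-xor (odd m) (odd n))

odd-double : ∀ n → odd (n ℕ.+ n) ≡ false
odd-double n = trans (odd-+ n n) (Bool.xor-same (odd n))

module _ {A : Set} where

  length-filter-map : ∀ {Q : List A → Set} (Q? : U.Decidable Q) e Rs →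
    length (filter Q? (map (e ∷_) Rs)) ≡ length (filter (Q? ∘ (e ∷_)) Rs)
  length-filter-map Q? e [] = refl
  length-filter-map Q? e (R ∷ Rs) with does (Q? (e ∷ R))
  ... | true  = cong suc (length-filter-map Q? e Rs)
  ... | false = length-filter-map Q? e Rs

  xorSublists-odd : ∀ {Q : List A → Set} (Q? : U.Decidable Q) es →
    xorSublists (does ∘ Q?) es ≡ odd (length (filter Q? (sublists es)))
  xorSublists-odd Q? [] with does (Q? [])
  ... | true  = refl
  ... | false = refl
  xorSublists-odd Q? (e ∷ es) = begin
    xorSublists (does ∘ Q? ∘ (e ∷_)) es xor xorSublists (does ∘ Q?) es
      ≡⟨ cong₂ _xor_ (xorSublists-odd (Q? ∘ (e ∷_)) es) (xorSublists-odd Q? es) ⟩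
    odd (length (filter (Q? ∘ (e ∷_)) (sublists es))) xor odd (length (filter Q? (sublists es)))
      ≡⟨ cong (λ l → odd l xor odd (length (filter Q? (sublists es)))) (length-filter-map Q? e (sublists es)) ⟨
    odd (length (filter Q? (map (e ∷_) (sublists es)))) xor odd (length (filter Q? (sublists es)))
      ≡⟨ odd-+ (length (filter Q? (map (e ∷_) (sublists es)))) _ ⟨
    odd (length (filter Q? (map (e ∷_) (sublists es))) ℕ.+ length (filter Q? (sublists es)))
      ≡⟨ cong odd (length-++ (filter Q? (map (e ∷_) (sublists es)))) ⟨
    odd (length (filter Q? (map (e ∷_) (sublists es)) ++ filter Q? (sublists es)))
      ≡⟨ cong (odd ∘ length) (filter-++ Q? (map (e ∷_) (sublists es)) (sublists es)) ⟨
    odd (length (filter Q? (sublists (e ∷ es)))) ∎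
    where open ≡-Reasoning

  length-filter-complement : ∀ {Q : A → Set} (Q? : U.Decidable Q) xs →
    length xs ≡ length (filter Q? xs) ℕ.+ length (filter (¬? ∘ Q?) xs)
  length-filter-complement Q? [] = refl
  length-filter-complement Q? (x ∷ xs) with does (Q? x)
  ... | true  = cong suc (length-filter-complement Q? xs)
  ... | false = trans (cong suc (length-filter-complement Q? xs)) (sym (ℕ.+-suc _ _))

-- Sums modulo 2 over finite index sets

⨁ : ∀ {n} → (Fin n → Bool) → Bool
⨁ {zero}  f = false
⨁ {suc n} f = f zero xor ⨁ (f ∘ suc)

⨁-cong : ∀ {n} {f g : Fin n → Bool} → f ≗ g → ⨁ f ≡ ⨁ g
⨁-cong {zero}  f≗g = refl
⨁-cong {suc n} f≗g = cong₂ _xor_ (f≗g zero) (⨁-cong (f≗g ∘ suc))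

infix 4 _≤ᶠ_ _≠ᶠ_

_≤ᶠ_ : ∀ {n} → Fin n → Fin n → Bool
zero  ≤ᶠ j     = true
suc i ≤ᶠ zero  = false
suc i ≤ᶠ suc j = i ≤ᶠ j

_≠ᶠ_ : ∀ {n} → Fin n → Fin n → Bool
i ≠ᶠ j = (j ≤ᶠ i) xor (i ≤ᶠ j)

⨁-true : ∀ n → ⨁ {n} (λ _ → true) ≡ odd n
⨁-true zero    = refl
⨁-true (suc n) = cong not (⨁-true n)

⨁-≠ : ∀ {n} (j : Fin n) → ⨁ (j ≠ᶠ_) ≡ not (odd n)
⨁-≠ {suc n} zero    = trans (⨁-true n) (sym (Bool.not-involutive (odd n)))
⨁-≠ {suc n} (suc j) = cong not (⨁-≠ j)

-- Modulo 2 the matrix with entries [i ≠ j] of odd order is idempotent.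
⨁-≠suc : ∀ {n} → odd n ≡ false → (j : Fin (suc n)) → ⨁ (λ i → j ≠ᶠ suc i) ≡ (j ≠ᶠ zero)
⨁-≠suc {n} even zero    = trans (⨁-true n) even
⨁-≠suc {n} even (suc j) = trans (⨁-≠ j) (cong not even)

sum-single : ∀ {n} (f : Fin n → ℤ) j → (∀ i → i ≢ j → f i ≡ 0ℤ) → sum f ≡ f j
sum-single {suc n} f zero    f≡0 = trans
  (cong (f zero +_) (trans (∑.sum-cong-≗ λ i → f≡0 (suc i) λ ()) (∑.sum-replicate-zero n)))
  (ℤ.+-identityʳ (f zero))
sum-single {suc n} f (suc j) f≡0 = trans
  (cong₂ _+_ (f≡0 zero λ ()) (sum-single (f ∘ suc) j λ i i≢j → f≡0 (suc i) (i≢j ∘ Fin.suc-injective)))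
  (ℤ.+-identityˡ (f (suc j)))

-- Integer chains, boundaries and counting circulations modulo 2

module Chains (G : FiniteSimpleGraph) where
  open FiniteSimpleGraph G renaming (V to Vertex)
  open Circulations G
  private
    Arc = Vertex × Vertex
    to  = Inverse.to index

  Chain : Set
  Chain = Vertex → ℤ

  tick : Vertex → Vertex → ℕ
  tick u v = if does (u ≟ᵥ v) then 1 else 0

  δ : Vertex → Chain
  δ u v = pos (tick u v)

  δ-refl : ∀ v → δ v v ≡ 1ℤ
  δ-refl v = cong (λ b → pos (if b then 1 else 0)) (dec-true (v ≟ᵥ v) refl)

  δ-≢ : ∀ {u v} → u ≢ v → δ u v ≡ 0ℤ
  δ-≢ {u} {v} u≢v = cong (λ b → pos (if b then 1 else 0)) (dec-false (u ≟ᵥ v) u≢v)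

  infixl 6 _⊕_
  _⊕_ : Chain → Chain → Chain
  (x ⊕ y) v = x v + y v

  _⊖_ : Vertex → Vertex → Chain
  (u ⊖ v) w = δ u w - δ v w

  𝟘 : Chain
  𝟘 _ = 0ℤ

  -- Tail minus head, so that the boundary of a set of arcs is outdegree minus indegree and
  -- circulations are the sets with boundary zero.
  ∂ : Arc → Chain
  ∂ (u , v) = u ⊖ v

  ∂-off : ∀ {u v w} → u ≢ w → v ≢ w → (u ⊖ v) w ≡ 0ℤ
  ∂-off u≢w v≢w = cong₂ _-_ (δ-≢ u≢w) (δ-≢ v≢w)

  Respectful : (Chain → Bool) → Set
  Respectful Φ = ∀ {x y} → x ≗ y → Φ x ≡ Φ y

  -- The parity of the number of sublists R of es for which Φ holds at the sum of x and
  -- the boundaries of the arcs in R.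
  count : (Chain → Bool) → List Arc → Chain → Bool
  count Φ []       x = Φ x
  count Φ (e ∷ es) x = count Φ es (x ⊕ ∂ e) xor count Φ es x

  module _ {Φ : Chain → Bool} (Φ-resp : Respectful Φ) where

    count-resp : ∀ es → Respectful (count Φ es)
    count-resp []       x≗y = Φ-resp x≗y
    count-resp (e ∷ es) x≗y = cong₂ _xor_ (count-resp es (λ v → cong (_+ ∂ e v) (x≗y v))) (count-resp es x≗y)

    -- Addition of chains is commutative, so arcs may be decided in any convenient order.
    count-↭ : ∀ {es fs} → es ↭ fs → ∀ x → count Φ es x ≡ count Φ fs x
    count-↭ ↭.refl          x = refl
    count-↭ (↭.prep e p)    x = cong₂ _xor_ (count-↭ p (x ⊕ ∂ e)) (count-↭ p x)
    count-↭ (↭.swap {es} {fs} e f p) x = begin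
      (count Φ es (x ⊕ ∂ e ⊕ ∂ f) xor count Φ es (x ⊕ ∂ e)) xor (count Φ es (x ⊕ ∂ f) xor count Φ es x)
        ≡⟨ interchange (count Φ es (x ⊕ ∂ e ⊕ ∂ f)) _ _ _ ⟩
      (count Φ es (x ⊕ ∂ e ⊕ ∂ f) xor count Φ es (x ⊕ ∂ f)) xor (count Φ es (x ⊕ ∂ e) xor count Φ es x)
        ≡⟨ cong₂ _xor_ (cong₂ _xor_ (trans (count-resp es (λ v → reorder (x v) (∂ e v) (∂ f v))) (count-↭ p _)) (count-↭ p _))
                       (cong₂ _xor_ (count-↭ p _) (count-↭ p x)) ⟩
      (count Φ fs (x ⊕ ∂ f ⊕ ∂ e) xor count Φ fs (x ⊕ ∂ f)) xor (count Φ fs (x ⊕ ∂ e) xor count Φ fs x) ∎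
      where
      open ≡-Reasoning
      reorder : ∀ a b c → a + b + c ≡ a + c + b
      reorder = solve-∀
    count-↭ (↭.trans p q)   x = trans (count-↭ p x) (count-↭ q x)

  count-++ : ∀ {Φ} es fs x → count Φ (es ++ fs) x ≡ count (count Φ fs) es x
  count-++ []       fs x = refl
  count-++ (e ∷ es) fs x = cong₂ _xor_ (count-++ es fs (x ⊕ ∂ e)) (count-++ es fs x)

  -- An invariant argument: if `Bad` persists when an arc is used, it reaches the end of every
  -- choice of arcs. The later vanishing arguments are instances of it.
  count-false : ∀ {Φ} (Bad : Chain → Set) → (∀ {y} → Bad y → Φ y ≡ false) →
    ∀ {es} → All (λ e → ∀ {y} → Bad y → Bad (y ⊕ ∂ e)) es → ∀ {x} → Bad x → count Φ es x ≡ false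
  count-false Bad bad []            x-bad = bad x-bad
  count-false Bad bad (pres ∷ rest) x-bad =
    cong₂ _xor_ (count-false Bad bad rest (pres x-bad)) (count-false Bad bad rest x-bad)

  isZero : Chain → Bool
  isZero x = does (allᵥ? λ v → x v ℤ.≟ 0ℤ)

  isZero-resp : Respectful isZero
  isZero-resp {x} {y} x≗y = does-⇔ (mk⇔ (λ x≡0 v → trans (sym (x≗y v)) (x≡0 v)) (λ y≡0 v → trans (x≗y v) (y≡0 v)))
    (allᵥ? λ v → x v ℤ.≟ 0ℤ) (allᵥ? λ v → y v ℤ.≟ 0ℤ)

  isZero-𝟘 : isZero 𝟘 ≡ true
  isZero-𝟘 = dec-true (allᵥ? λ v → 𝟘 v ℤ.≟ 0ℤ) (λ _ → refl)

  isZero-false : ∀ {x} v → x v ≢ 0ℤ → isZero x ≡ false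
  isZero-false {x} v xv≢0 = dec-false (allᵥ? λ v → x v ℤ.≟ 0ℤ) (λ x≡0 → xv≢0 (x≡0 v))

  -- The pairing of a potential with a chain; on the boundary of an arc it gives the drop of `h`
  -- from tail to head.
  total : (Vertex → ℤ) → Chain → ℤ
  total h x = sum λ i → h (vertex i) * x (vertex i)

  total-⊕ : ∀ h x y → total h (x ⊕ y) ≡ total h x + total h y
  total-⊕ h x y = trans
    (∑.sum-cong-≗ λ i → ℤ.*-distribˡ-+ (h (vertex i)) (x (vertex i)) (y (vertex i)))
    (∑.∑-distrib-+ (λ i → h (vertex i) * x (vertex i)) (λ i → h (vertex i) * y (vertex i)))

  total-δ : ∀ h v → total h (δ v) ≡ h v
  total-δ h v = begin
    total h (δ v)                                 ≡⟨ sum-single _ (to v) off ⟩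
    h (vertex (to v)) * δ v (vertex (to v))       ≡⟨ cong (λ u → h u * δ v u) (vertex-to v) ⟩
    h v * δ v v                                   ≡⟨ cong (h v *_) (δ-refl v) ⟩
    h v * 1ℤ                                      ≡⟨ ℤ.*-identityʳ (h v) ⟩
    h v                                           ∎
    where
    open ≡-Reasoning
    off : ∀ i → i ≢ to v → h (vertex i) * δ v (vertex i) ≡ 0ℤ
    off i i≢v = trans (cong (h (vertex i) *_) (δ-≢ λ v≡i → i≢v (trans (sym (to-vertex i)) (cong to (sym v≡i)))))
      (ℤ.*-zeroʳ (h (vertex i)))

  total-⊖ : ∀ h u v → total h (u ⊖ v) ≡ h u - h v
  total-⊖ h u v = begin
    total h (u ⊖ v)
      ≡⟨ ∑.sum-cong-≗ (λ i → split (h (vertex i)) (δ u (vertex i)) (δ v (vertex i))) ⟩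
    (sum λ i → h (vertex i) * δ u (vertex i) + -1ℤ * (h (vertex i) * δ v (vertex i)))
      ≡⟨ ∑.∑-distrib-+ (λ i → h (vertex i) * δ u (vertex i)) (λ i → -1ℤ * (h (vertex i) * δ v (vertex i))) ⟩
    total h (δ u) + (sum λ i → -1ℤ * (h (vertex i) * δ v (vertex i)))
      ≡⟨ cong (total h (δ u) +_) (∑.*-distribˡ-sum -1ℤ (λ i → h (vertex i) * δ v (vertex i))) ⟨
    total h (δ u) + -1ℤ * total h (δ v)
      ≡⟨ cong₂ (λ a b → a + -1ℤ * b) (total-δ h u) (total-δ h v) ⟩
    h u + -1ℤ * h v
      ≡⟨ cong (h u +_) (ℤ.-1*i≡-i (h v)) ⟩
    h u - h v ∎
    where
    open ≡-Reasoning
    split : ∀ a b c → a * (b - c) ≡ a * b + -1ℤ * (a * c)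
    split = solve-∀

  total-step : ∀ h x u v → total h (x ⊕ ∂ (u , v)) ≡ total h x + (h u - h v)
  total-step h x u v = trans (total-⊕ h x (u ⊖ v)) (cong (total h x +_) (total-⊖ h u v))

  total-𝟘 : ∀ h → total h 𝟘 ≡ 0ℤ
  total-𝟘 h = trans (∑.sum-cong-≗ λ i → ℤ.*-zeroʳ (h (vertex i))) (∑.sum-replicate-zero size)

  isZero-total : ∀ h {x} → total h x ≢ 0ℤ → isZero x ≡ false
  isZero-total h {x} total≢0 = dec-false (allᵥ? λ v → x v ℤ.≟ 0ℤ) λ x≡0 → total≢0
    (trans (∑.sum-cong-≗ λ i → cong (h (vertex i) *_) (x≡0 (vertex i))) (total-𝟘 h))

  -- A circulation contains no arc along which a potential that never decreases increases.
  count-drop : ∀ h es → All (λ (u , v) → h u ℤ.≤ h v) es → ∀ x → total h x ≡ 0ℤ →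
    count isZero es x ≡ count isZero (filter (λ (u , v) → h u ℤ.≟ h v) es) x
  count-drop h [] [] x x≡0 = refl
  count-drop h ((u , v) ∷ es) (u≤v ∷ mono) x x≡0 with h u ℤ.≟ h v
  ... | yes u≡v = cong₂ _xor_
    (count-drop h es mono (x ⊕ ∂ (u , v)) (trans (total-step h x u v) (cong₂ _+_ x≡0 (ℤ.i≡j⇒i-j≡0 u≡v))))
    (count-drop h es mono x x≡0)
  ... | no  u≢v = cong₂ _xor_
    -- Using a strictly rising arc makes the total negative, and no remaining arc can bring it back
    -- up to zero.
    (count-false (λ y → total h y ℤ.< 0ℤ) (λ {y} neg → isZero-total h {y} (ℤ.<⇒≢ neg)) (All.map keep mono) below)
    (count-drop h es mono x x≡0)
    where
    below : total h (x ⊕ ∂ (u , v)) ℤ.< 0ℤ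
    below = subst (ℤ._< 0ℤ) (sym (trans (total-step h x u v) (trans (cong (_+ (h u - h v)) x≡0) (ℤ.+-identityˡ (h u - h v)))))
      (ℤ.≤∧≢⇒< (ℤ.i≤j⇒i-j≤0 u≤v) (u≢v ∘ ℤ.i-j≡0⇒i≡j (h u) (h v)))
    keep : ∀ {e} → h (proj₁ e) ℤ.≤ h (proj₂ e) → ∀ {y} → total h y ℤ.< 0ℤ → total h (y ⊕ ∂ e) ℤ.< 0ℤ
    keep {u , v} u≤v {y} neg = subst (ℤ._< 0ℤ) (sym (total-step h y u v)) (ℤ.+-mono-<-≤ neg (ℤ.i≤j⇒i-j≤0 u≤v))

  boundary : List Arc → Chain
  boundary es = foldr (λ e y → ∂ e ⊕ y) 𝟘 es

  count≡xorSublists : ∀ {Φ} → Respectful Φ → ∀ es x → count Φ es x ≡ xorSublists (λ R → Φ (x ⊕ boundary R)) es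
  count≡xorSublists Φ-resp [] x = Φ-resp λ v → sym (ℤ.+-identityʳ (x v))
  count≡xorSublists Φ-resp (e ∷ es) x = cong₂ _xor_
    (trans (count≡xorSublists Φ-resp es (x ⊕ ∂ e))
      (xorSublists-cong (λ R → Φ-resp λ v → ℤ.+-assoc (x v) (∂ e v) (boundary R v)) es))
    (count≡xorSublists Φ-resp es x)

  degree-tick : ∀ end e es v → degree end (e ∷ es) v ≡ tick (end e) v ℕ.+ degree end es v
  degree-tick end e es v with end e ≟ᵥ v
  ... | yes e≡v = trans (cong length (filter-accept (λ e → end e ≟ᵥ v) e≡v))
    (cong (λ b → (if b then 1 else 0) ℕ.+ degree end es v) (sym (dec-true (end e ≟ᵥ v) e≡v)))
  ... | no  e≢v = trans (cong length (filter-reject (λ e → end e ≟ᵥ v) e≢v))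
    (cong (λ b → (if b then 1 else 0) ℕ.+ degree end es v) (sym (dec-false (end e ≟ᵥ v) e≢v)))

  boundary≡degrees : ∀ R v → boundary R v ≡ pos (outdegree G R v) - pos (indegree G R v)
  boundary≡degrees [] v = refl
  boundary≡degrees (e@(t , h) ∷ R) v = begin
    δ t v - δ h v + boundary R v
      ≡⟨ cong (δ t v - δ h v +_) (boundary≡degrees R v) ⟩
    δ t v - δ h v + (pos (outdegree G R v) - pos (indegree G R v))
      ≡⟨ regroup (δ t v) (δ h v) (pos (outdegree G R v)) (pos (indegree G R v)) ⟩
    (δ t v + pos (outdegree G R v)) - (δ h v + pos (indegree G R v))
      ≡⟨ cong₂ (λ a b → pos a - pos b) (degree-tick proj₁ e R v) (degree-tick proj₂ e R v) ⟨
    pos (outdegree G (e ∷ R) v) - pos (indegree G (e ∷ R) v) ∎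
    where
    open ≡-Reasoning
    regroup : ∀ a b c d → a - b + (c - d) ≡ (a + c) - (b + d)
    regroup = solve-∀

  isZero-circulation : (circ? : U.Decidable (IsCirculation G)) → ∀ R → isZero (𝟘 ⊕ boundary R) ≡ does (circ? R)
  isZero-circulation circ? R = does-⇔ (mk⇔ balanced zeroes) (allᵥ? λ v → (𝟘 ⊕ boundary R) v ℤ.≟ 0ℤ) (circ? R)
    where
    difference-𝟘 : ∀ v → (𝟘 ⊕ boundary R) v ≡ pos (outdegree G R v) - pos (indegree G R v)
    difference-𝟘 v = trans (ℤ.+-identityˡ (boundary R v)) (boundary≡degrees R v)
    balanced : (∀ v → (𝟘 ⊕ boundary R) v ≡ 0ℤ) → IsCirculation G R
    balanced x≡0 v = sym (ℤ.+-injective (ℤ.i-j≡0⇒i≡j _ _ (trans (sym (difference-𝟘 v)) (x≡0 v))))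
    zeroes : IsCirculation G R → ∀ v → (𝟘 ⊕ boundary R) v ≡ 0ℤ
    zeroes circ v = trans (difference-𝟘 v) (ℤ.i≡j⇒i-j≡0 (cong pos (sym (circ v))))

  -- Two equal numbers have an even sum, but the even and odd circulations together are odd in
  -- number.
  odd⇒EE≢EO : ∀ es (circ? : U.Decidable (IsCirculation G)) (even? : U.Decidable λ (R : List Arc) → 2 ∣ length R) →
    count isZero es 𝟘 ≡ true →
    length (filter even? (filter circ? (sublists es))) ≢ length (filter (¬? ∘ even?) (filter circ? (sublists es)))
  odd⇒EE≢EO es circ? even? odd-count EE≡EO = contradiction odd-count (Bool.not-¬ (begin
    count isZero es 𝟘
      ≡⟨ count≡xorSublists isZero-resp es 𝟘 ⟩
    xorSublists (λ R → isZero (𝟘 ⊕ boundary R)) es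
      ≡⟨ xorSublists-cong (isZero-circulation circ?) es ⟩
    xorSublists (does ∘ circ?) es
      ≡⟨ xorSublists-odd circ? es ⟩
    odd (length (filter circ? (sublists es)))
      ≡⟨ cong odd (length-filter-complement even? (filter circ? (sublists es))) ⟩
    odd (EE ℕ.+ EO)
      ≡⟨ cong (λ n → odd (EE ℕ.+ n)) EE≡EO ⟨
    odd (EE ℕ.+ EE)
      ≡⟨ odd-double EE ⟩
    false ∎))
    where
    open ≡-Reasoning
    EE = length (filter even? (filter circ? (sublists es)))
    EO = length (filter (¬? ∘ even?) (filter circ? (sublists es)))

separate : ∀ {A : Set} {Q : A → Set} {xs ys : List A} → All Q xs → All (¬_ ∘ Q) ys → Disjoint xs ys
separate q ¬q (x∈xs , x∈ys) = All.lookup ¬q x∈ys (All.lookup q x∈xs)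

-- Directed cycles joined by vertical arcs

module Ladders (G : FiniteSimpleGraph) where
  open FiniteSimpleGraph G renaming (V to Vertex)
  open Circulations G
  open Chains G
  private
    Arc = Vertex × Vertex

  Avoids : Vertex → Arc → Set
  Avoids w (u , v) = u ≢ w × v ≢ w

  -- Models the situation in which no arc still to be decided touches `w`: a nonzero value there can
  -- no longer be repaired.
  VanishesOff : Vertex → (Chain → Bool) → Set
  VanishesOff w Φ = ∀ {y} → y w ≢ 0ℤ → Φ y ≡ false

  count-avoids : ∀ {Φ es w} → VanishesOff w Φ → All (Avoids w) es → VanishesOff w (count Φ es)
  count-avoids {w = w} off avoids = count-false (λ y → y w ≢ 0ℤ) off
    (All.map (λ (u≢w , v≢w) {y} yw≢0 eq → yw≢0 (trans (sym (trans (cong (y w +_) (∂-off u≢w v≢w)) (ℤ.+-identityʳ (y w)))) eq)) avoids)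

  path : ∀ {n} → (Fin (suc n) → Vertex) → List Arc
  path {zero}  g = []
  path {suc n} g = (g (suc zero) , g zero) ∷ path (g ∘ suc)

  -- A directed cycle: the path descends through the indices and the closing arc leads from `zero`
  -- to the last index.
  row : ∀ {n} → (Fin (suc n) → Vertex) → List Arc
  row {n} g = (g zero , g (fromℕ n)) ∷ path g

  path-avoids : ∀ {n} (g : Fin (suc n) → Vertex) {w} → (∀ i → g i ≢ w) → All (Avoids w) (path g)
  path-avoids {zero}  g g≢w = []
  path-avoids {suc n} g g≢w = (g≢w (suc zero) , g≢w zero) ∷ path-avoids (g ∘ suc) (g≢w ∘ suc)

  private
    ≢0-by : ∀ {x} n → x ≡ n → n ≢ 0ℤ → x ≢ 0ℤ
    ≢0-by n x≡n n≢0 x≡0 = n≢0 (trans (sym x≡n) x≡0)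

  -- The descent from `b` to `a` is the only set of path arcs that cancels `g a ⊖ g b`, and it
  -- exists exactly when `a ≤ b`. Only the first path arc touches `g zero`, so the value there
  -- decides whether it is used.
  count-path : ∀ {Φ n} → Respectful Φ → (g : Fin (suc n) → Vertex) → Injective _≡_ _≡_ g →
    (∀ i → VanishesOff (g i) Φ) → ∀ {z} → (∀ i → z (g i) ≡ 0ℤ) → ∀ a b →
    count Φ (path g) ((g a ⊖ g b) ⊕ z) ≡ (a ≤ᶠ b) ∧ Φ z
  count-path {n = zero} Φ-resp g g-inj off {z} z≡0 zero zero = Φ-resp λ v → cancel (δ (g zero) v) (z v)
    where
    cancel : ∀ a b → a - a + b ≡ b
    cancel = solve-∀
  count-path {Φ} {n = suc n} Φ-resp g g-inj off {z} z≡0 = go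
    where
    g₀ = g zero
    g₁ = g (suc zero)
    e  = g₁ , g₀

    gᵢ≢g₀ : ∀ i → g (suc i) ≢ g₀
    gᵢ≢g₀ i eq = contradiction (g-inj eq) λ ()

    δ₀₀ : δ g₀ g₀ ≡ 1ℤ
    δ₀₀ = δ-refl g₀

    δᵢ₀ : ∀ i → δ (g (suc i)) g₀ ≡ 0ℤ
    δᵢ₀ i = δ-≢ (gᵢ≢g₀ i)

    rest : VanishesOff g₀ (count Φ (path (g ∘ suc)))
    rest = count-avoids (off zero) (path-avoids (g ∘ suc) gᵢ≢g₀)

    IH : ∀ a b → count Φ (path (g ∘ suc)) ((g (suc a) ⊖ g (suc b)) ⊕ z) ≡ (a ≤ᶠ b) ∧ Φ z
    IH = count-path Φ-resp (g ∘ suc) (Fin.suc-injective ∘ g-inj) (off ∘ suc) (z≡0 ∘ suc)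

    at₀ : ∀ {u v p q} → δ u g₀ ≡ p → δ v g₀ ≡ q → ((u ⊖ v) ⊕ z) g₀ ≡ p - q + 0ℤ
    at₀ u≡p v≡q = cong₂ _+_ (cong₂ _-_ u≡p v≡q) (z≡0 zero)

    at₀⊕∂ : ∀ {u v p q} → δ u g₀ ≡ p → δ v g₀ ≡ q → ((u ⊖ v) ⊕ z ⊕ ∂ e) g₀ ≡ p - q + 0ℤ + -1ℤ
    at₀⊕∂ u≡p v≡q = cong₂ _+_ (at₀ u≡p v≡q) (cong₂ _-_ (δᵢ₀ zero) δ₀₀)

    go : ∀ a b → count Φ (path g) ((g a ⊖ g b) ⊕ z) ≡ (a ≤ᶠ b) ∧ Φ z
    go zero zero = cong₂ _xor_
      (rest (≢0-by -1ℤ (at₀⊕∂ δ₀₀ δ₀₀) λ ()))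
      (trans (count-resp Φ-resp (path (g ∘ suc)) λ v → same (δ g₀ v) (δ g₁ v) (z v)) (IH zero zero))
      where
      same : ∀ a b c → a - a + c ≡ b - b + c
      same = solve-∀
    go zero (suc b) = trans (cong₂ _xor_
      (trans (count-resp Φ-resp (path (g ∘ suc)) λ v → slide (δ g₀ v) (δ g₁ v) (δ (g (suc b)) v) (z v)) (IH zero b))
      (rest (≢0-by 1ℤ (at₀ δ₀₀ (δᵢ₀ b)) λ ()))) (Bool.xor-identityʳ _)
      where
      slide : ∀ a b c d → a - c + d + (b - a) ≡ b - c + d
      slide = solve-∀
    go (suc a) zero = cong₂ _xor_
      (rest (≢0-by (pos 0 - pos 2) (at₀⊕∂ (δᵢ₀ a) δ₀₀) λ ()))
      (rest (≢0-by -1ℤ (at₀ (δᵢ₀ a) δ₀₀) λ ()))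
    go (suc a) (suc b) = cong₂ _xor_
      (rest (≢0-by -1ℤ (at₀⊕∂ (δᵢ₀ a) (δᵢ₀ b)) λ ()))
      (IH a b)

  -- With the closing arc used, the path must supply the descents from the last index to `a` and
  -- from `b` to `zero`. They share no arc exactly when `b ≤ a`, and no other set of path arcs has
  -- the required boundary.
  count-path-around : ∀ {Φ n} → Respectful Φ → (g : Fin (suc n) → Vertex) → Injective _≡_ _≡_ g →
    (∀ i → VanishesOff (g i) Φ) → ∀ {z} → (∀ i → z (g i) ≡ 0ℤ) → ∀ a b →
    count Φ (path g) ((g a ⊖ g b) ⊕ z ⊕ (g zero ⊖ g (fromℕ n))) ≡ (b ≤ᶠ a) ∧ Φ z
  count-path-around {n = zero} Φ-resp g g-inj off {z} z≡0 zero zero = Φ-resp λ v → cancel (δ (g zero) v) (z v)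
    where
    cancel : ∀ a b → a - a + b + (a - a) ≡ b
    cancel = solve-∀
  count-path-around {Φ} {n = suc n} Φ-resp g g-inj off {z} z≡0 = go
    where
    g₀ = g zero
    g₁ = g (suc zero)
    gₙ = g (fromℕ (suc n))
    e  = g₁ , g₀

    gᵢ≢g₀ : ∀ i → g (suc i) ≢ g₀
    gᵢ≢g₀ i eq = contradiction (g-inj eq) λ ()

    δ₀₀ : δ g₀ g₀ ≡ 1ℤ
    δ₀₀ = δ-refl g₀

    δᵢ₀ : ∀ i → δ (g (suc i)) g₀ ≡ 0ℤ
    δᵢ₀ i = δ-≢ (gᵢ≢g₀ i)

    rest : VanishesOff g₀ (count Φ (path (g ∘ suc)))
    rest = count-avoids (off zero) (path-avoids (g ∘ suc) gᵢ≢g₀)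

    IH : ∀ a b → count Φ (path (g ∘ suc)) ((g (suc a) ⊖ g (suc b)) ⊕ z ⊕ (g₁ ⊖ gₙ)) ≡ (b ≤ᶠ a) ∧ Φ z
    IH = count-path-around Φ-resp (g ∘ suc) (Fin.suc-injective ∘ g-inj) (off ∘ suc) (z≡0 ∘ suc)

    at₀ : ∀ {u v p q} → δ u g₀ ≡ p → δ v g₀ ≡ q → ((u ⊖ v) ⊕ z ⊕ (g₀ ⊖ gₙ)) g₀ ≡ p - q + 0ℤ + 1ℤ
    at₀ u≡p v≡q = cong₂ _+_ (cong₂ _+_ (cong₂ _-_ u≡p v≡q) (z≡0 zero)) (cong₂ _-_ δ₀₀ (δᵢ₀ (fromℕ n)))

    at₀⊕∂ : ∀ {u v p q} → δ u g₀ ≡ p → δ v g₀ ≡ q → ((u ⊖ v) ⊕ z ⊕ (g₀ ⊖ gₙ) ⊕ ∂ e) g₀ ≡ p - q + 0ℤ + 1ℤ + -1ℤ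
    at₀⊕∂ u≡p v≡q = cong₂ _+_ (at₀ u≡p v≡q) (cong₂ _-_ (δᵢ₀ zero) δ₀₀)

    go : ∀ a b → count Φ (path g) ((g a ⊖ g b) ⊕ z ⊕ (g₀ ⊖ gₙ)) ≡ (b ≤ᶠ a) ∧ Φ z
    go zero zero = trans (cong₂ _xor_
      (trans (count-resp Φ-resp (path (g ∘ suc)) λ v → slide (δ g₀ v) (δ g₁ v) (δ gₙ v) (z v)) (IH zero zero))
      (rest (≢0-by 1ℤ (at₀ δ₀₀ δ₀₀) λ ()))) (Bool.xor-identityʳ _)
      where
      slide : ∀ a b c d → a - a + d + (a - c) + (b - a) ≡ b - b + d + (b - c)
      slide = solve-∀
    go zero (suc b) = cong₂ _xor_
      (rest (≢0-by 1ℤ (at₀⊕∂ δ₀₀ (δᵢ₀ b)) λ ()))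
      (rest (≢0-by (pos 2) (at₀ δ₀₀ (δᵢ₀ b)) λ ()))
    go (suc a) zero = cong₂ _xor_
      (rest (≢0-by -1ℤ (at₀⊕∂ (δᵢ₀ a) δ₀₀) λ ()))
      (trans (count-resp Φ-resp (path (g ∘ suc)) λ v → slide (δ g₀ v) (δ g₁ v) (δ gₙ v) (δ (g (suc a)) v) (z v)) (IH a zero))
      where
      slide : ∀ a b c d e → d - a + e + (a - c) ≡ d - b + e + (b - c)
      slide = solve-∀
    go (suc a) (suc b) = trans (cong₂ _xor_
      (trans (count-resp Φ-resp (path (g ∘ suc)) λ v → slide (δ g₀ v) (δ g₁ v) (δ gₙ v) (δ (g (suc a)) v) (δ (g (suc b)) v) (z v)) (IH a b))
      (rest (≢0-by 1ℤ (at₀ (δᵢ₀ a) (δᵢ₀ b)) λ ()))) (Bool.xor-identityʳ _)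
      where
      slide : ∀ a b c d e f → d - e + f + (a - c) + (b - a) ≡ d - e + f + (b - c)
      slide = solve-∀

  -- Exactly one set of arcs of the row has boundary g b ⊖ g a if a ≠ b, but two do (the empty
  -- set and the whole cycle) if a = b.
  count-row : ∀ {Φ n} → Respectful Φ → (g : Fin (suc n) → Vertex) → Injective _≡_ _≡_ g →
    (∀ i → VanishesOff (g i) Φ) → ∀ {z} → (∀ i → z (g i) ≡ 0ℤ) → ∀ a b →
    count Φ (row g) ((g a ⊖ g b) ⊕ z) ≡ (a ≠ᶠ b) ∧ Φ z
  count-row {Φ} Φ-resp g g-inj off {z} z≡0 a b = trans
    (cong₂ _xor_ (count-path-around Φ-resp g g-inj off z≡0 a b) (count-path Φ-resp g g-inj off z≡0 a b))
    (sym (Bool.∧-distribʳ-xor (Φ z) (b ≤ᶠ a) (a ≤ᶠ b)))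

  VanishesOffKernel : (Vertex → ℤ) → (Chain → Bool) → Set
  VanishesOffKernel h Φ = ∀ {y} → total h y ≢ 0ℤ → Φ y ≡ false

  -- Arcs inside a level set of `h` do not change `total h`, so a nonzero total persists.
  count-conserves : ∀ h {Φ es} → VanishesOffKernel h Φ → All (λ (u , v) → h u ≡ h v) es → VanishesOffKernel h (count Φ es)
  count-conserves h off level = count-false (λ y → total h y ≢ 0ℤ) off (All.map (λ {e} → keep {e}) level)
    where
    keep : ∀ {e} → h (proj₁ e) ≡ h (proj₂ e) → ∀ {y} → total h y ≢ 0ℤ → total h (y ⊕ ∂ e) ≢ 0ℤ
    keep {u , v} hu≡hv {y} y≢0 eq = y≢0 (trans (sym (trans (total-step h y u v)
      (trans (cong (total h y +_) (ℤ.i≡j⇒i-j≡0 hu≡hv)) (ℤ.+-identityʳ (total h y))))) eq)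

  module _ {Φ : Chain → Bool} (h : Vertex → ℤ) (off : VanishesOffKernel h Φ) where

    private
      step : ∀ {x u v} n → h u - h v ≡ 1ℤ → total h x ≡ n → total h (x ⊕ ∂ (u , v)) ≡ n + 1ℤ
      step {x} {u} {v} n rise x≡n = trans (total-step h x u v) (cong₂ _+_ x≡n rise)

    -- Each arc raises the total by one, so starting from zero the use of any arc overshoots for
    -- good.
    count-none : ∀ {es} → All (λ (u , v) → h u - h v ≡ 1ℤ) es → ∀ {x} → total h x ≡ 0ℤ → count Φ es x ≡ Φ x
    count-none []              x≡0 = refl
    count-none {(u , v) ∷ es} (rise ∷ rises) {x} x≡0 = cong₂ _xor_
      (count-false (λ y → 0ℤ ℤ.< total h y) (λ {y} y>0 → off {y} (≢-sym (ℤ.<⇒≢ y>0))) (All.map (λ {e} → keep {e}) rises) {x ⊕ ∂ (u , v)} above)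
      (count-none rises {x} x≡0)
      where
      above : 0ℤ ℤ.< total h (x ⊕ ∂ (u , v))
      above = subst (0ℤ ℤ.<_) (sym (step {x} {u} {v} 0ℤ rise x≡0)) (ℤ.+<+ (s≤s z≤n))
      keep : ∀ {e} → h (proj₁ e) - h (proj₂ e) ≡ 1ℤ → ∀ {y} → 0ℤ ℤ.< total h y → 0ℤ ℤ.< total h (y ⊕ ∂ e)
      keep {u , v} rise {y} y>0 = subst (0ℤ ℤ.<_) (sym (step {y} {u} {v} (total h y) rise refl))
        (ℤ.+-mono-<-≤ y>0 (ℤ.+≤+ z≤n))

    -- Each arc raises the total by one, so starting from -1 exactly one of them has to be used; the
    -- sum runs over that arc.
    count-one : ∀ {n} (f : Fin n → Arc) → (∀ i → h (proj₁ (f i)) - h (proj₂ (f i)) ≡ 1ℤ) → ∀ {x} → total h x ≡ -1ℤ →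
      count Φ (tabulate f) x ≡ ⨁ λ i → Φ (x ⊕ ∂ (f i))
    count-one {zero}  f rises {x} x≡-1 = off {x} λ x≡0 → contradiction (trans (sym x≡-1) x≡0) λ ()
    count-one {suc n} f rises {x} x≡-1 = cong₂ _xor_
      (count-none (All.tabulate⁺ (rises ∘ suc)) {x ⊕ ∂ (f zero)} (step {x} {proj₁ (f zero)} {proj₂ (f zero)} -1ℤ (rises zero) x≡-1))
      (count-one (f ∘ suc) (rises ∘ suc) {x} x≡-1)

  vertical : ∀ {m} → (Fin (suc m) → Vertex) → (Fin (suc m) → Vertex) → List Arc
  vertical g g′ = (g zero , g′ zero) ∷ tabulate λ i → g′ (suc i) , g (suc i)

  -- `ladderTail` lacks only the closing arc of the first row, so that `cycleArcs` can put the
  -- reversed arc in its place.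
  ladderTail ladder : ∀ {n m} → (Fin (suc n) → Fin (suc m) → Vertex) → List Arc
  ladderTail {zero}  r = path (r zero)
  ladderTail {suc n} r = path (r zero) ++ vertical (r zero) (r (suc zero)) ++ ladder (r ∘ suc)
  ladder {m = m} r = (r zero zero , r zero (fromℕ m)) ∷ ladderTail r

  path-all : ∀ {m} (g : Fin (suc m) → Vertex) {Q : Arc → Set} →
    (∀ i → Q (g (suc i) , g (inject₁ i))) → All Q (path g)
  path-all {zero}  g q = []
  path-all {suc m} g q = q zero ∷ path-all (g ∘ suc) (q ∘ suc)

  ladderTail-all : ∀ {n m} (r : Fin (suc n) → Fin (suc m) → Vertex) {Q : Arc → Set} →
    (∀ t i → Q (r t (suc i) , r t (inject₁ i))) →
    (∀ (t : Fin n) → Q (r (suc t) zero , r (suc t) (fromℕ m))) →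
    (∀ (t : Fin n) → Q (r (inject₁ t) zero , r (suc t) zero)) →
    (∀ (t : Fin n) i → Q (r (suc t) (suc i) , r (inject₁ t) (suc i))) →
    All Q (ladderTail r)
  ladderTail-all {zero}  r q-path q-close q-down q-up = path-all (r zero) (q-path zero)
  ladderTail-all {suc n} r q-path q-close q-down q-up = All.++⁺ (path-all (r zero) (q-path zero))
    (All.++⁺ (q-down zero ∷ All.tabulate⁺ (q-up zero))
      (q-close zero ∷ ladderTail-all (r ∘ suc) (q-path ∘ suc) (q-close ∘ suc) (q-down ∘ suc) (q-up ∘ suc)))

  row-⊆ : ∀ {m} (g : Fin (suc m) → Vertex) {Q : Vertex → Set} → (∀ i → Q (g i)) →
    All (λ (u , v) → Q u × Q v) (row g)
  row-⊆ {m} g q = (q zero , q (fromℕ m)) ∷ path-all g (λ i → q (suc i) , q (inject₁ i))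

  ladder-⊆ : ∀ {n m} (r : Fin (suc n) → Fin (suc m) → Vertex) {Q : Vertex → Set} → (∀ t i → Q (r t i)) →
    All (λ (u , v) → Q u × Q v) (ladder r)
  ladder-⊆ {m = m} r q = (q zero zero , q zero (fromℕ m)) ∷ ladderTail-all r
    (λ t i → q t (suc i) , q t (inject₁ i))
    (λ t → q (suc t) zero , q (suc t) (fromℕ m))
    (λ t → q (inject₁ t) zero , q (suc t) zero)
    (λ t i → q (suc t) (suc i) , q (inject₁ t) (suc i))

  -- A transfer-matrix induction that splits off the first layer. If the vertical arcs used are the
  -- one at `zero` and the one at `suc i`, the first row has to settle `j` against `suc i`, and the
  -- other layers pose the same problem with `suc i` for `j`. Summing over `i`, idempotence of the
  -- matrix modulo 2 reproduces the entry for `j` and `zero`.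
  count-ladder : ∀ {n m} → odd m ≡ false → (level : Vertex → ℕ) → ∀ b (r : Fin (suc n) → Fin (suc m) → Vertex) →
    (∀ t i → level (r t i) ≡ b ℕ.+ toℕ t) → (∀ t → Injective _≡_ _≡_ (r t)) →
    ∀ j → count isZero (ladder r) (r zero j ⊖ r zero zero) ≡ (j ≠ᶠ zero)
  count-ladder {zero} {m} even level b r r-level r-inj j = begin
    count isZero (row (r zero)) (r zero j ⊖ r zero zero)
      ≡⟨ count-resp isZero-resp (row (r zero)) (λ v → sym (ℤ.+-identityʳ ((r zero j ⊖ r zero zero) v))) ⟩
    count isZero (row (r zero)) ((r zero j ⊖ r zero zero) ⊕ 𝟘)
      ≡⟨ count-row isZero-resp (r zero) (r-inj zero) (λ i {y} → isZero-false {y} (r zero i)) (λ _ → refl) j zero ⟩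
    (j ≠ᶠ zero) ∧ isZero 𝟘
      ≡⟨ trans (cong ((j ≠ᶠ zero) ∧_) isZero-𝟘) (Bool.∧-identityʳ (j ≠ᶠ zero)) ⟩
    (j ≠ᶠ zero) ∎
    where open ≡-Reasoning
  count-ladder {suc n} {m} even level b r r-level r-inj j = begin
    count isZero (row r₀ ++ vertical r₀ r₁ ++ ladder (r ∘ suc)) x
      -- The vertical arcs are decided first, since they alone change the total of `h`, the
      -- indicator of the layers after the first.
      ≡⟨ count-↭ isZero-resp (shifts (row r₀) (vertical r₀ r₁)) x ⟩
    count isZero (vertical r₀ r₁ ++ row r₀ ++ ladder (r ∘ suc)) x
      ≡⟨ count-++ (vertical r₀ r₁) (row r₀ ++ ladder (r ∘ suc)) x ⟩
    count Ψ (tabulate up) (x ⊕ ∂ down) xor count Ψ (tabulate up) x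
      ≡⟨ cong₂ _xor_ (count-one h (λ {y} → Ψ-kernel {y}) up up-rises {x ⊕ ∂ down} x⊕down≡-1)
                     (count-none h (λ {y} → Ψ-kernel {y}) (All.tabulate⁺ up-rises) {x} x≡0) ⟩
    (⨁ λ i → Ψ (x ⊕ ∂ down ⊕ ∂ (up i))) xor Ψ x
      ≡⟨ cong₂ _xor_ (⨁-cong Ψ-round) Ψ-flat ⟩
    (⨁ λ i → j ≠ᶠ suc i) xor false
      ≡⟨ Bool.xor-identityʳ _ ⟩
    (⨁ λ i → j ≠ᶠ suc i)
      ≡⟨ ⨁-≠suc even j ⟩
    (j ≠ᶠ zero) ∎
    where
    open ≡-Reasoning
    r₀ r₁ : Fin (suc m) → Vertex
    r₀ = r zero
    r₁ = r (suc zero)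
    x : Chain
    x = r₀ j ⊖ r₀ zero
    down : Arc
    down = r₀ zero , r₁ zero
    up : Fin m → Arc
    up i = r₁ (suc i) , r₀ (suc i)

    Φ Ψ : Chain → Bool
    Φ = count isZero (ladder (r ∘ suc))
    Ψ = count isZero (row r₀ ++ ladder (r ∘ suc))

    Φ-resp : Respectful Φ
    Φ-resp = count-resp isZero-resp (ladder (r ∘ suc))

    IH : ∀ j → Φ (r₁ j ⊖ r₁ zero) ≡ (j ≠ᶠ zero)
    IH = count-ladder even level (suc b) (r ∘ suc)
      (λ t i → trans (r-level (suc t) i) (ℕ.+-suc b (toℕ t))) (r-inj ∘ suc)

    level₀ : ∀ i → level (r₀ i) ≡ b
    level₀ i = trans (r-level zero i) (ℕ.+-identityʳ b)

    level₊ : ∀ t i → b < level (r (suc t) i)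
    level₊ t i = subst (b <_) (sym (r-level (suc t) i)) (ℕ.m<m+n b (s≤s z≤n))

    r₀≢ : ∀ i t k → r (suc t) k ≢ r₀ i
    r₀≢ i t k eq = ℕ.<⇒≢ (level₊ t k) (trans (sym (level₀ i)) (cong level (sym eq)))

    Φ-off : ∀ i → VanishesOff (r₀ i) Φ
    Φ-off i = count-avoids (λ {y} → isZero-false {y} (r₀ i)) (ladder-⊆ (r ∘ suc) (r₀≢ i))

    -- The cut between the first layer and the rest: the `down` arc lowers `total h` by one and each
    -- `up` arc raises it by one, so they must be used in pairs.
    h : Vertex → ℤ
    h v = if does (b ℕ.<? level v) then 1ℤ else 0ℤ

    h₀ : ∀ i → h (r₀ i) ≡ 0ℤ
    h₀ i = cong (λ t → if t then 1ℤ else 0ℤ) (dec-false (b ℕ.<? level (r₀ i)) λ b<b → ℕ.<-irrefl (sym (level₀ i)) b<b)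

    h₊ : ∀ t i → h (r (suc t) i) ≡ 1ℤ
    h₊ t i = cong (λ t → if t then 1ℤ else 0ℤ) (dec-true (b ℕ.<? level (r (suc t) i)) (level₊ t i))

    Ψ-kernel : VanishesOffKernel h Ψ
    Ψ-kernel {y} = count-conserves h (λ {y} → isZero-total h {y}) (All.++⁺
      (All.map (λ (p , q) → trans p (sym q)) (row-⊆ r₀ {λ v → h v ≡ 0ℤ} h₀))
      (All.map (λ (p , q) → trans p (sym q)) (ladder-⊆ (r ∘ suc) {λ v → h v ≡ 1ℤ} h₊))) {y}

    up-rises : ∀ i → h (proj₁ (up i)) - h (proj₂ (up i)) ≡ 1ℤ
    up-rises i = cong₂ _-_ (h₊ zero (suc i)) (h₀ (suc i))

    x≡0 : total h x ≡ 0ℤ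
    x≡0 = trans (total-⊖ h (r₀ j) (r₀ zero)) (cong₂ _-_ (h₀ j) (h₀ zero))

    x⊕down≡-1 : total h (x ⊕ ∂ down) ≡ -1ℤ
    x⊕down≡-1 = trans (total-step h x (r₀ zero) (r₁ zero)) (cong₂ _+_ x≡0 (cong₂ _-_ (h₀ zero) (h₊ zero zero)))

    Ψ-row : ∀ k {z} → (∀ i → z (r₀ i) ≡ 0ℤ) → Ψ ((r₀ j ⊖ r₀ k) ⊕ z) ≡ (j ≠ᶠ k) ∧ Φ z
    Ψ-row k z≡0 = trans (count-++ (row r₀) (ladder (r ∘ suc)) _)
      (count-row Φ-resp r₀ (r-inj zero) Φ-off z≡0 j k)

    Ψ-resp : Respectful Ψ
    Ψ-resp = count-resp isZero-resp (row r₀ ++ ladder (r ∘ suc))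

    -- The circulations of the remaining layers alone are even in number: this is the induction
    -- hypothesis at `zero`. Hence using no vertical arc contributes nothing.
    Φ-𝟘 : Φ 𝟘 ≡ false
    Φ-𝟘 = trans (Φ-resp λ v → sym (ℤ.+-inverseʳ (δ (r₁ zero) v))) (IH zero)

    Ψ-flat : Ψ x ≡ false
    Ψ-flat = trans (Ψ-resp λ v → sym (ℤ.+-identityʳ (x v)))
      (trans (Ψ-row zero {𝟘} λ _ → refl) (trans (cong ((j ≠ᶠ zero) ∧_) Φ-𝟘) (Bool.∧-zeroʳ (j ≠ᶠ zero))))

    Ψ-round : ∀ i → Ψ (x ⊕ ∂ down ⊕ ∂ (up i)) ≡ (j ≠ᶠ suc i)
    Ψ-round i = begin
      Ψ (x ⊕ ∂ down ⊕ ∂ (up i))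
        ≡⟨ Ψ-resp (λ v → reroute (δ (r₀ j) v) (δ (r₀ zero) v) (δ (r₁ zero) v) (δ (r₁ (suc i)) v) (δ (r₀ (suc i)) v)) ⟩
      Ψ ((r₀ j ⊖ r₀ (suc i)) ⊕ (r₁ (suc i) ⊖ r₁ zero))
        ≡⟨ Ψ-row (suc i) (λ k → ∂-off (r₀≢ k zero (suc i)) (r₀≢ k zero zero)) ⟩
      (j ≠ᶠ suc i) ∧ Φ (r₁ (suc i) ⊖ r₁ zero)
        ≡⟨ trans (cong ((j ≠ᶠ suc i) ∧_) (IH (suc i))) (Bool.∧-identityʳ (j ≠ᶠ suc i)) ⟩
      (j ≠ᶠ suc i) ∎
      where
      reroute : ∀ a b c d e → a - b + (b - c) + (d - e) ≡ a - e + (d - c)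
      reroute = solve-∀

  -- Membership and distinctness of the ladder arcs

  path-∈ : ∀ {m} (g : Fin (suc m) → Vertex) i → (g (suc i) , g (inject₁ i)) ∈ path g
  path-∈ g zero    = here refl
  path-∈ {suc (suc m)} g (suc i) = there (path-∈ (g ∘ suc) i)

  ladderTail-∈-path : ∀ {n m} (r : Fin (suc n) → Fin (suc m) → Vertex) t i →
    (r t (suc i) , r t (inject₁ i)) ∈ ladderTail r
  ladderTail-∈-path {zero}  r zero    i = path-∈ (r zero) i
  ladderTail-∈-path {suc n} r zero    i = ∈-++⁺ˡ (path-∈ (r zero) i)
  ladderTail-∈-path {suc n} r (suc t) i = ∈-++⁺ʳ (path (r zero)) (∈-++⁺ʳ (vertical (r zero) (r (suc zero)))
    (there (ladderTail-∈-path (r ∘ suc) t i)))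

  ladderTail-∈-close : ∀ {n m} (r : Fin (suc n) → Fin (suc m) → Vertex) t →
    (r (suc t) zero , r (suc t) (fromℕ m)) ∈ ladderTail r
  ladderTail-∈-close {suc n} r zero    = ∈-++⁺ʳ (path (r zero)) (∈-++⁺ʳ (vertical (r zero) (r (suc zero))) (here refl))
  ladderTail-∈-close {suc n} r (suc t) = ∈-++⁺ʳ (path (r zero)) (∈-++⁺ʳ (vertical (r zero) (r (suc zero)))
    (there (ladderTail-∈-close (r ∘ suc) t)))

  ladderTail-∈-down : ∀ {n m} (r : Fin (suc n) → Fin (suc m) → Vertex) t →
    (r (inject₁ t) zero , r (suc t) zero) ∈ ladderTail r
  ladderTail-∈-down {suc n} r zero    = ∈-++⁺ʳ (path (r zero)) (here refl)
  ladderTail-∈-down {suc n} r (suc t) = ∈-++⁺ʳ (path (r zero)) (∈-++⁺ʳ (vertical (r zero) (r (suc zero)))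
    (there (ladderTail-∈-down (r ∘ suc) t)))

  ladderTail-∈-up : ∀ {n m} (r : Fin (suc n) → Fin (suc m) → Vertex) t i →
    (r (suc t) (suc i) , r (inject₁ t) (suc i)) ∈ ladderTail r
  ladderTail-∈-up {suc n} r zero    i = ∈-++⁺ʳ (path (r zero)) (there (∈-++⁺ˡ (∈-tabulate⁺ i)))
  ladderTail-∈-up {suc n} r (suc t) i = ∈-++⁺ʳ (path (r zero)) (∈-++⁺ʳ (vertical (r zero) (r (suc zero)))
    (there (ladderTail-∈-up (r ∘ suc) t i)))

  path-unique : ∀ {m} (g : Fin (suc m) → Vertex) → Injective _≡_ _≡_ g → Unique (path g)
  path-unique {zero}  g g-inj = []
  path-unique {suc m} g g-inj =
    path-all (g ∘ suc) (λ i eq → contradiction (g-inj (cong proj₂ eq)) λ ()) ∷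
    path-unique (g ∘ suc) (Fin.suc-injective ∘ g-inj)

  -- The first path, the vertical arcs next to it and the remaining ladder have two, one and no ends
  -- on level `b` respectively, so they are disjoint.
  ladderTail-unique : ∀ {n m} (level : Vertex → ℕ) b (r : Fin (suc n) → Fin (suc m) → Vertex) →
    (∀ t i → level (r t i) ≡ b ℕ.+ toℕ t) → (∀ t → Injective _≡_ _≡_ (r t)) → Unique (ladderTail r)
  ladderTail-unique {zero}  level b r r-level r-inj = path-unique (r zero) (r-inj zero)
  ladderTail-unique {suc n} {m} level b r r-level r-inj = Unique.++⁺ (path-unique r₀ (r-inj zero))
    (Unique.++⁺ vertical-unique
      (ladderTail-all (r ∘ suc)
        (λ t i eq → start≢ t (cong proj₁ eq))
        (λ t eq → contradiction (same-level (suc zero) (suc (suc t)) (cong proj₁ eq)) λ ())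
        (λ t eq → contradiction (same-level (suc zero) (suc (suc t)) (cong proj₂ eq)) λ ())
        (λ t i eq → contradiction (same-level (suc zero) (suc (suc t)) (cong proj₁ eq)) λ ())
       ∷ ladderTail-unique level (suc b) (r ∘ suc)
           (λ t i → trans (r-level (suc t) i) (ℕ.+-suc b (toℕ t))) (r-inj ∘ suc))
      (separate {Q = λ (u , v) → level u ≡ b ⊎ level v ≡ b}
        (inj₁ (level₀ zero) ∷ All.tabulate⁺ (λ i → inj₂ (level₀ (suc i))))
        (All.map (λ (p , q) → [ p , q ]′) (ladder-⊆ (r ∘ suc) {λ v → level v ≢ b} level₊))))
    (separate {Q = λ (u , v) → level u ≡ b × level v ≡ b}
      (path-all r₀ λ i → level₀ (suc i) , level₀ (inject₁ i))
      (All.++⁺ ((λ (_ , q) → level₊ zero zero q) ∷ All.tabulate⁺ (λ i (p , _) → level₊ zero (suc i) p))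
        (All.map (λ (p , _) (p′ , _) → p p′) (ladder-⊆ (r ∘ suc) {λ v → level v ≢ b} level₊))))
    where
    r₀ r₁ : Fin (suc m) → Vertex
    r₀ = r zero
    r₁ = r (suc zero)

    same-level : ∀ t t′ {i i′} → r t i ≡ r t′ i′ → t ≡ t′
    same-level t t′ {i} {i′} eq = Fin.toℕ-injective (ℕ.+-cancelˡ-≡ b _ _ (trans (sym (r-level t i)) (trans (cong level eq) (r-level t′ i′))))

    start≢ : ∀ t {i} → r₁ zero ≢ r (suc t) (suc i)
    start≢ t eq with same-level (suc zero) (suc t) eq
    ... | refl = contradiction (r-inj (suc zero) eq) λ ()

    level₀ : ∀ i → level (r₀ i) ≡ b
    level₀ i = trans (r-level zero i) (ℕ.+-identityʳ b)

    level₊ : ∀ t i → level (r (suc t) i) ≢ b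
    level₊ t i eq = ℕ.m+1+n≢m b (trans (sym (r-level (suc t) i)) eq)

    vertical-unique : Unique (vertical r₀ r₁)
    vertical-unique =
      All.tabulate⁺ (λ i eq → level₊ zero (suc i) (trans (sym (cong (level ∘ proj₁) eq)) (level₀ zero))) ∷
      Unique.tabulate⁺ (λ eq → Fin.suc-injective (r-inj zero (cong proj₂ eq)))

-- Indegree bounds and the criterion for the Alon-Tarsi number

unique-⊆-length : ∀ {A : Set} {xs ys : List A} → Unique xs → (∀ {x} → x ∈ xs → x ∈ ys) → length xs ≤ length ys
unique-⊆-length {xs = xs} {ys} xs! xs⊆ys = Fin.injective⇒≤ {f = λ i → Any.index (xs⊆ys (∈-lookup i))} λ {i} {j} eq →
  lookup-injective xs! i j (trans (lookup-index (xs⊆ys (∈-lookup i)))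
    (trans (cong (lookup ys) eq) (sym (lookup-index (xs⊆ys (∈-lookup j))))))

choosable⇒colorable : ∀ G {k} → Choosable G k → Colorable G k
choosable⇒colorable G {k} choose = colour (choose (λ _ → upTo k) (λ _ → Unique.upTo⁺ k) (λ _ → ℕ.≤-reflexive (sym (length-upTo k))))
  where
  colour : (∃[ f ] IsProper G f × (∀ v → f v ∈ upTo k)) → Colorable G k
  colour (f , f-proper , f∈) = (λ v → fromℕ< (∈-upTo⁻ (f∈ v))) ,
    λ u~v eq → f-proper u~v (Fin.fromℕ<-injective _ _ _ _ eq)

module _ (G : FiniteSimpleGraph) (D : Orientation G) where
  open FiniteSimpleGraph G renaming (V to Vertex)
  open Orientation D

  ∈-arcs⁻ : ∀ {u v} → (u , v) ∈ arcs G D → u ⇾ v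
  ∈-arcs⁻ uv∈arcs = proj₂ (∈-filter⁻ (λ (u , v) → u ⇾? v) {xs = cartesianProduct vertices vertices} uv∈arcs)

  arcs-unique : Unique (arcs G D)
  arcs-unique = Unique.filter⁺ (λ (u , v) → u ⇾? v) (Unique.cartesianProduct⁺ vertices-unique vertices-unique)
    where
    vertices-unique : Unique vertices
    vertices-unique = Unique.map⁺
      (λ {i} {j} eq → trans (sym (Circulations.to-vertex G i)) (trans (cong (Inverse.to index) eq) (Circulations.to-vertex G j)))
      (Unique.allFin⁺ size)

  -- The arcs into `v` are distinct and determined by their tails, so any list covering the possible
  -- tails bounds their number; it may contain further vertices.
  indegree-arcs : ∀ v ys → (∀ u → u ⇾ v → u ∈ ys) → indegree G (arcs G D) v ≤ length ys
  indegree-arcs v ys sources = subst (indegree G (arcs G D) v ≤_) (length-map (_, v) ys)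
    (unique-⊆-length (Unique.filter⁺ (λ e → proj₂ e ≟ᵥ v) arcs-unique) covered)
    where
    covered : ∀ {e} → e ∈ filter (λ e → proj₂ e ≟ᵥ v) (arcs G D) → e ∈ map (_, v) ys
    covered {u , w} e∈ = covered′ (∈-filter⁻ (λ e → proj₂ e ≟ᵥ v) {xs = arcs G D} e∈)
      where
      covered′ : (u , w) ∈ arcs G D × w ≡ v → (u , w) ∈ map (_, v) ys
      covered′ (e∈arcs , refl) = ∈-map⁺ (_, v) (sources u (∈-arcs⁻ e∈arcs))

  maxIndegree-≤ : ∀ k → (∀ v → indegree G (arcs G D) v ≤ k) → maxIndegree G D ≤ k
  maxIndegree-≤ k bound = max≤v⁺ {xs = map (indegree G (arcs G D)) vertices} z≤n
    (All.map⁺ (All.tabulate {xs = vertices} λ {v} _ → bound v))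

  open Chains G

  count-arcs-drop : ∀ h → (∀ {u v} → u ⇾ v → h u ℤ.≤ h v) →
    count isZero (arcs G D) 𝟘 ≡ count isZero (filter (λ (u , v) → h u ℤ.≟ h v) (arcs G D)) 𝟘
  count-arcs-drop h mono = count-drop h (arcs G D) (All.tabulate λ e∈ → mono (∈-arcs⁻ e∈)) 𝟘 (total-𝟘 h)

  -- A sandwich: the odd count makes `D` an Alon-Tarsi orientation, which bounds the list chromatic
  -- number from above, while the chromatic number bounds everything from below.
  certificate : ∀ {k} → count isZero (arcs G D) 𝟘 ≡ true → maxIndegree G D ≤ k →
    (∀ {j} → Colorable G j → suc k ≤ j) → IsAlonTarsiNumber G (suc k) × ChromaticChoosable G
  certificate {k} odd-count max≤k colorable⇒≥ =
    (orientable , λ j → choosable⇒≥ ∘ alonTarsi G) ,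
    (suc k , (choosable⇒colorable G choosable-k , λ j → colorable⇒≥) , (choosable-k , λ j → choosable⇒≥))
    where
    EE≢EO : #evenCirculations G D ≢ #oddCirculations G D
    EE≢EO = odd⇒EE≢EO (arcs G D) (isCirculation? G) (λ R → 2 ∣? length R) odd-count

    choosable⇒≥ : ∀ {j} → Choosable G j → suc k ≤ j
    choosable⇒≥ = colorable⇒≥ ∘ choosable⇒colorable G

    orientable : HasAlonTarsiOrientation G (suc k)
    -- The Alon-Tarsi theorem for the actual maximum indegree of `D` yields a colouring, so this
    -- indegree cannot be smaller than `k`.
    orientable = D , ℕ.≤-antisym (s≤s max≤k) (choosable⇒≥ (alonTarsi G (D , refl , EE≢EO))) , EE≢EO

    choosable-k : Choosable G (suc k)
    choosable-k = alonTarsi G orientable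

-- An orientation of (K m ∨ C (2k+1)) □ P n

module Tower (m c″ n : ℕ) (even : odd c″ ≡ false) where

  private
    -- The last index of the cycle, whose length `suc c` is odd and at least 3.
    c : ℕ
    c = suc (suc c″)
    G : FiniteSimpleGraph
    G = (K m ∨ C (suc c)) □ P (suc n)
    Vertex Arc : Set
    Vertex = (Fin m ⊎ Fin (suc c)) × Fin (suc n)
    Arc = Vertex × Vertex

  open Chains G using (isZero; isZero-resp; count; count-↭; count-resp; 𝟘; δ; ∂; _⊕_; _⊖_)
  open Ladders G using (ladder; ladderTail; ladderTail-all; ladderTail-unique; ladderTail-∈-path;
    ladderTail-∈-close; ladderTail-∈-down; ladderTail-∈-up; count-ladder)

  -- Only the closing arc distinguishes the bottom layer. If that layer were a directed cycle too,
  -- the number of circulations would be even, by the case `j = zero` of `count-ladder`.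
  RowArc : Fin (suc n) → Rel (Fin (suc c)) 0ℓ
  RowArc zero    i j = suc (toℕ j) ≡ toℕ i ⊎ (toℕ i ≡ c × toℕ j ≡ 0)
  RowArc (suc _) i j = suc (toℕ j) ≡ toℕ i ⊎ (toℕ i ≡ 0 × toℕ j ≡ c)

  RungArc : Fin (suc c) → Rel (Fin (suc n)) 0ℓ
  RungArc zero    t t′ = suc (toℕ t) ≡ toℕ t′
  RungArc (suc _) t t′ = suc (toℕ t′) ≡ toℕ t

  infix 4 _⇾_ _⇾?_

  _⇾_ : Rel Vertex 0ℓ
  (inj₁ a , t) ⇾ (inj₁ b , t′) = (t ≡ t′ × toℕ a < toℕ b) ⊎ (a ≡ b × suc (toℕ t) ≡ toℕ t′)
  (inj₁ a , t) ⇾ (inj₂ j , t′) = t ≡ t′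
  (inj₂ i , t) ⇾ (inj₁ b , t′) = ⊥
  (inj₂ i , t) ⇾ (inj₂ j , t′) = (t ≡ t′ × RowArc t i j) ⊎ (i ≡ j × RungArc i t t′)

  rowArc? : ∀ t → Decidable (RowArc t)
  rowArc? zero    i j = (suc (toℕ j) ℕ.≟ toℕ i) ⊎-dec ((toℕ i ℕ.≟ c) ×-dec (toℕ j ℕ.≟ 0))
  rowArc? (suc _) i j = (suc (toℕ j) ℕ.≟ toℕ i) ⊎-dec ((toℕ i ℕ.≟ 0) ×-dec (toℕ j ℕ.≟ c))

  rungArc? : ∀ i → Decidable (RungArc i)
  rungArc? zero    t t′ = suc (toℕ t) ℕ.≟ toℕ t′
  rungArc? (suc _) t t′ = suc (toℕ t′) ℕ.≟ toℕ t

  _⇾?_ : Decidable _⇾_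
  (inj₁ a , t) ⇾? (inj₁ b , t′) = ((t Fin.≟ t′) ×-dec (toℕ a ℕ.<? toℕ b)) ⊎-dec ((a Fin.≟ b) ×-dec (suc (toℕ t) ℕ.≟ toℕ t′))
  (inj₁ a , t) ⇾? (inj₂ j , t′) = t Fin.≟ t′
  (inj₂ i , t) ⇾? (inj₁ b , t′) = no λ ()
  (inj₂ i , t) ⇾? (inj₂ j , t′) = ((t Fin.≟ t′) ×-dec rowArc? t i j) ⊎-dec ((i Fin.≟ j) ×-dec rungArc? i t t′)

  open FiniteSimpleGraph using (_~_)

  step-≢ : ∀ {k} {i j : Fin k} → suc (toℕ i) ≡ toℕ j → i ≢ j
  step-≢ p refl = ℕ.1+n≢n p

  ends-≢ : ∀ {k} {i j : Fin k} → toℕ i ≡ c → toℕ j ≡ 0 → i ≢ j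
  ends-≢ p q refl = contradiction (trans (sym p) q) λ ()

  rowArc-sound : ∀ t {i j} → RowArc t i j → _~_ (C (suc c)) i j
  rowArc-sound zero    (inj₁ p)       = ≢-sym (step-≢ p) , inj₂ (inj₁ p)
  rowArc-sound zero    (inj₂ (p , q)) = ends-≢ p q , inj₁ (inj₂ (cong suc p , q))
  rowArc-sound (suc _) (inj₁ p)       = ≢-sym (step-≢ p) , inj₂ (inj₁ p)
  rowArc-sound (suc _) (inj₂ (p , q)) = ≢-sym (ends-≢ q p) , inj₂ (inj₂ (cong suc q , p))

  rungArc-sound : ∀ i {t t′} → RungArc i t t′ → _~_ (P (suc n)) t t′
  rungArc-sound zero    p = step-≢ p , inj₁ p
  rungArc-sound (suc _) p = ≢-sym (step-≢ p) , inj₂ p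

  ⇾-sound : ∀ {u v} → u ⇾ v → _~_ G u v
  ⇾-sound {inj₁ a , t} {inj₁ b , t′} (inj₁ (t≡t′ , a<b)) = inj₂ (t≡t′ , (λ { refl → ℕ.<-irrefl refl a<b }) , inj₁ _)
  ⇾-sound {inj₁ a , t} {inj₁ b , t′} (inj₂ (refl , p))   = inj₁ (refl , step-≢ p , inj₁ p)
  ⇾-sound {inj₁ a , t} {inj₂ j , t′} t≡t′                = inj₂ (t≡t′ , _)
  ⇾-sound {inj₂ i , t} {inj₂ j , t′} (inj₁ (t≡t′ , p))   = inj₂ (t≡t′ , rowArc-sound t p)
  ⇾-sound {inj₂ i , t} {inj₂ j , t′} (inj₂ (refl , p))   = inj₁ (refl , rungArc-sound i p)

  rowArc-step : ∀ t {i j} → suc (toℕ j) ≡ toℕ i → RowArc t i j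
  rowArc-step zero    p = inj₁ p
  rowArc-step (suc _) p = inj₁ p

  rowArc-close : ∀ t {i j} → toℕ i ≡ c → toℕ j ≡ 0 → RowArc t i j ⊎ RowArc t j i
  rowArc-close zero    p q = inj₁ (inj₂ (p , q))
  rowArc-close (suc _) p q = inj₂ (inj₂ (q , p))

  rowArc-total : ∀ t {i j} → _~_ (C (suc c)) i j → RowArc t i j ⊎ RowArc t j i
  rowArc-total t (_ , inj₁ (inj₁ p))       = inj₂ (rowArc-step t p)
  rowArc-total t (_ , inj₁ (inj₂ (p , q))) = rowArc-close t (ℕ.suc-injective p) q
  rowArc-total t (_ , inj₂ (inj₁ p))       = inj₁ (rowArc-step t p)
  rowArc-total t (_ , inj₂ (inj₂ (p , q))) = swap⊎ (rowArc-close t (ℕ.suc-injective p) q)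

  rungArc-total : ∀ i {t t′} → _~_ (P (suc n)) t t′ → RungArc i t t′ ⊎ RungArc i t′ t
  rungArc-total zero    (_ , p) = p
  rungArc-total (suc _) (_ , p) = swap⊎ p

  apart : ∀ {i j} → i ≢ j → i < j ⊎ j < i
  apart {i} {j} i≢j with ℕ.<-cmp i j
  ... | tri< i<j _ _ = inj₁ i<j
  ... | tri≈ _ i≡j _ = contradiction i≡j i≢j
  ... | tri> _ _ i>j = inj₂ i>j

  ⇾-total : ∀ {u v} → _~_ G u v → u ⇾ v ⊎ v ⇾ u
  ⇾-total {inj₁ a , t} {inj₁ .a , t′} (inj₁ (refl , _ , p)) = [ (λ p → inj₁ (inj₂ (refl , p))) , (λ p → inj₂ (inj₂ (refl , p))) ]′ p
  ⇾-total {inj₁ a , t} {inj₁ b , .t} (inj₂ (refl , a≢b , _)) = [ (λ lt → inj₁ (inj₁ (refl , lt))) , (λ gt → inj₂ (inj₁ (refl , gt))) ]′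
    (apart (a≢b ∘ Fin.toℕ-injective))
  ⇾-total {inj₁ a , t} {inj₂ j , t′} (inj₂ (t≡t′ , _)) = inj₁ t≡t′
  ⇾-total {inj₂ i , t} {inj₁ b , t′} (inj₂ (t≡t′ , _)) = inj₂ (sym t≡t′)
  ⇾-total {inj₂ i , t} {inj₂ .i , t′} (inj₁ (refl , p)) = [ (λ p → inj₁ (inj₂ (refl , p))) , (λ p → inj₂ (inj₂ (refl , p))) ]′ (rungArc-total i p)
  ⇾-total {inj₂ i , t} {inj₂ j , .t} (inj₂ (refl , p)) = [ (λ p → inj₁ (inj₁ (refl , p))) , (λ p → inj₂ (inj₁ (refl , p))) ]′ (rowArc-total t p)

  steps-asym : ∀ {k} {i j : Fin k} → suc (toℕ i) ≡ toℕ j → suc (toℕ j) ≢ toℕ i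
  steps-asym p q = ℕ.<-asym (ℕ.≤-reflexive p) (ℕ.≤-reflexive q)

  rowArc-asym : ∀ t {i j} → RowArc t i j → ¬ RowArc t j i
  rowArc-asym zero    (inj₁ p)       (inj₁ q)       = steps-asym p q
  rowArc-asym zero    (inj₁ p)       (inj₂ (_ , q)) = contradiction (trans p q) λ ()
  rowArc-asym zero    (inj₂ (_ , p)) (inj₁ q)       = contradiction (trans q p) λ ()
  rowArc-asym zero    (inj₂ (p , _)) (inj₂ (_ , q)) = contradiction (trans (sym p) q) λ ()
  rowArc-asym (suc _) (inj₁ p)       (inj₁ q)       = steps-asym p q
  rowArc-asym (suc _) (inj₁ p)       (inj₂ (q , r)) = contradiction (trans (cong suc (sym q)) (trans p r)) λ ()
  rowArc-asym (suc _) (inj₂ (p , q)) (inj₁ r)       = contradiction (trans (cong suc (sym p)) (trans r q)) λ ()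
  rowArc-asym (suc _) (inj₂ (p , _)) (inj₂ (_ , q)) = contradiction (trans (sym p) q) λ ()

  rungArc-asym : ∀ i {t t′} → RungArc i t t′ → ¬ RungArc i t′ t
  rungArc-asym zero    p q = steps-asym p q
  rungArc-asym (suc _) p q = steps-asym p q

  rungArc-irrefl : ∀ i {t} → ¬ RungArc i t t
  rungArc-irrefl zero    p = ℕ.1+n≢n p
  rungArc-irrefl (suc _) p = ℕ.1+n≢n p

  ⇾-asym : ∀ {u v} → u ⇾ v → ¬ (v ⇾ u)
  ⇾-asym {inj₁ a , t} {inj₁ b , t′} (inj₁ (_ , p))    (inj₁ (_ , q))    = ℕ.<-asym p q
  ⇾-asym {inj₁ a , t} {inj₁ b , t′} (inj₁ (_ , p))    (inj₂ (refl , _)) = ℕ.<-irrefl refl p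
  ⇾-asym {inj₁ a , t} {inj₁ b , t′} (inj₂ (refl , _)) (inj₁ (_ , q))    = ℕ.<-irrefl refl q
  ⇾-asym {inj₁ a , t} {inj₁ b , t′} (inj₂ (_ , p))    (inj₂ (_ , q))    = steps-asym p q
  ⇾-asym {inj₂ i , t} {inj₂ j , t′} (inj₁ (refl , p)) (inj₁ (_ , q))    = rowArc-asym t p q
  ⇾-asym {inj₂ i , t} {inj₂ j , t′} (inj₁ (refl , _)) (inj₂ (refl , q)) = rungArc-irrefl i q
  ⇾-asym {inj₂ i , t} {inj₂ j , t′} (inj₂ (refl , p)) (inj₁ (refl , _)) = rungArc-irrefl i p
  ⇾-asym {inj₂ i , t} {inj₂ j , t′} (inj₂ (refl , p)) (inj₂ (_ , q))    = rungArc-asym i p q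

  D : Orientation G
  D = record
    { _⇾_ = _⇾_ ; _⇾?_ = _⇾?_
    ; sound = λ {u} {v} → ⇾-sound {u} {v}
    ; total = λ {u} {v} → ⇾-total {u} {v}
    ; asym = λ {u} {v} → ⇾-asym {u} {v}
    }

  -- Increases strictly along every arc that starts in a copy of `K m` and is constant on the
  -- cycles: `m + n` exceeds all values `toℕ a + toℕ t`. So circulations live on the cycle vertices
  -- only.
  potential : Vertex → ℤ
  potential (inj₁ a , t) = pos (toℕ a ℕ.+ toℕ t)
  potential (inj₂ i , t) = pos (m ℕ.+ n)

  potential-mono : ∀ {u v} → u ⇾ v → potential u ℤ.≤ potential v
  potential-mono {inj₁ a , t} {inj₁ b , t′} (inj₁ (refl , a<b)) = ℤ.+≤+ (ℕ.+-monoˡ-≤ (toℕ t) (ℕ.<⇒≤ a<b))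
  potential-mono {inj₁ a , t} {inj₁ b , t′} (inj₂ (refl , p))   = ℤ.+≤+ (ℕ.+-monoʳ-≤ (toℕ a) (ℕ.≤-trans (ℕ.n≤1+n (toℕ t)) (ℕ.≤-reflexive p)))
  potential-mono {inj₁ a , t} {inj₂ j , t′} _ = ℤ.+≤+ (ℕ.+-mono-≤ (ℕ.<⇒≤ (Fin.toℕ<n a)) (ℕ.≤-pred (Fin.toℕ<n t)))
  potential-mono {inj₂ i , t} {inj₂ j , t′} _ = ℤ.≤-refl

  rung : Fin (suc n) → Fin (suc c) → Vertex
  rung t i = inj₂ i , t

  bottom : Arc
  bottom = rung zero (fromℕ c) , rung zero zero

  cycleArcs : List Arc
  cycleArcs = bottom ∷ ladderTail rung

  fin-≡ : ∀ {k} {i j : Fin k} {l} → toℕ i ≡ l → toℕ j ≡ l → i ≡ j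
  fin-≡ p q = Fin.toℕ-injective (trans p (sym q))

  ∈-cycleArcs : ∀ {u v} → u ⇾ v → potential u ≡ potential v → (u , v) ∈ cycleArcs
  ∈-cycleArcs {inj₁ a , t} {inj₁ b , t′} (inj₁ (refl , a<b)) eq =
    contradiction (ℕ.+-cancelʳ-≡ (toℕ t) _ _ (ℤ.+-injective eq)) (ℕ.<⇒≢ a<b)
  ∈-cycleArcs {inj₁ a , t} {inj₁ b , t′} (inj₂ (refl , p)) eq =
    contradiction (trans p (sym (ℕ.+-cancelˡ-≡ (toℕ a) _ _ (ℤ.+-injective eq)))) ℕ.1+n≢n
  ∈-cycleArcs {inj₁ a , t} {inj₂ j , t′} _ eq =
    contradiction (ℤ.+-injective eq) (ℕ.<⇒≢ (ℕ.+-mono-<-≤ (Fin.toℕ<n a) (ℕ.≤-pred (Fin.toℕ<n t))))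
  ∈-cycleArcs {inj₂ i , t} {inj₂ j , t′} (inj₁ (refl , p)) _ = row-∈ t p
    where
    step-∈ : ∀ t {i j} → suc (toℕ j) ≡ toℕ i → (rung t i , rung t j) ∈ cycleArcs
    step-∈ t {suc i} {j} p with fin-≡ {i = j} (ℕ.suc-injective p) (Fin.toℕ-inject₁ i)
    ... | refl = there (ladderTail-∈-path rung t i)
    row-∈ : ∀ t {i j} → RowArc t i j → (rung t i , rung t j) ∈ cycleArcs
    row-∈ zero    (inj₁ p) = step-∈ zero p
    row-∈ (suc t) (inj₁ p) = step-∈ (suc t) p
    row-∈ zero    {i} {j} (inj₂ (p , q)) with fin-≡ {i = i} p (Fin.toℕ-fromℕ c) | fin-≡ {i = j} {zero} q refl
    ... | refl | refl = here refl
    row-∈ (suc t) {i} {j} (inj₂ (p , q)) with fin-≡ {i = i} {zero} p refl | fin-≡ {i = j} q (Fin.toℕ-fromℕ c)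
    ... | refl | refl = there (ladderTail-∈-close rung t)
  ∈-cycleArcs {inj₂ i , t} {inj₂ j , t′} (inj₂ (refl , p)) _ = rung-∈ i p
    where
    rung-∈ : ∀ i {t t′} → RungArc i t t′ → (rung t i , rung t′ i) ∈ cycleArcs
    rung-∈ zero {t} {suc t′} p with fin-≡ {i = t} (ℕ.suc-injective p) (Fin.toℕ-inject₁ t′)
    ... | refl = there (ladderTail-∈-down rung t′)
    rung-∈ (suc i) {suc t} {t′} p with fin-≡ {i = t′} (ℕ.suc-injective p) (Fin.toℕ-inject₁ t)
    ... | refl = there (ladderTail-∈-up rung t i)

  cycleArcs-⇾ : All (λ (u , v) → u ⇾ v × potential u ≡ potential v) cycleArcs
  cycleArcs-⇾ = (inj₁ (refl , inj₂ (Fin.toℕ-fromℕ c , refl)) , refl) ∷ ladderTail-all rung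
    (λ t i → inj₁ (refl , rowArc-step t (cong suc (Fin.toℕ-inject₁ i))) , refl)
    (λ t → inj₁ (refl , inj₂ (refl , Fin.toℕ-fromℕ c)) , refl)
    (λ t → inj₂ (refl , cong suc (Fin.toℕ-inject₁ t)) , refl)
    (λ t i → inj₂ (refl , cong suc (Fin.toℕ-inject₁ t)) , refl)

  level : Vertex → ℕ
  level (_ , t) = toℕ t

  rung-injective : ∀ t → Injective _≡_ _≡_ (rung t)
  rung-injective t refl = refl

  cycleArcs-unique : Unique cycleArcs
  cycleArcs-unique = ladderTail-all rung
      (λ { t zero eq → contradiction (cong proj₁ eq) λ () ; t (suc i) eq → contradiction (cong proj₂ eq) λ () })
      (λ t eq → contradiction (cong proj₁ eq) λ ())
      (λ t eq → contradiction (cong proj₂ eq) λ ())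
      (λ t i eq → contradiction (cong proj₁ eq) λ ())
    ∷ ladderTail-unique level 0 rung (λ _ _ → refl) rung-injective

  levelArcs : List Arc
  levelArcs = filter (λ (u , v) → potential u ℤ.≟ potential v) (arcs G D)

  levelArcs↭cycleArcs : levelArcs ↭ cycleArcs
  levelArcs↭cycleArcs = ∼bag⇒↭ (unique∧set⇒bag
    (Unique.filter⁺ (λ (u , v) → potential u ℤ.≟ potential v) (arcs-unique G D)) cycleArcs-unique (mk⇔ to from))
    where
    to : ∀ {e} → e ∈ levelArcs → e ∈ cycleArcs
    to {u , v} e∈ = ∈-cycleArcs {u} {v} (∈-arcs⁻ G D {u} {v} (proj₁ split)) (proj₂ split)
      where
      split : (u , v) ∈ arcs G D × potential u ≡ potential v
      split = ∈-filter⁻ (λ (u , v) → potential u ℤ.≟ potential v) {xs = arcs G D} e∈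
    from : ∀ {e} → e ∈ cycleArcs → e ∈ levelArcs
    from {u , v} e∈ = ∈-filter⁺ (λ (u , v) → potential u ℤ.≟ potential v)
      (∈-arcs⁺ G D (proj₁ (All.lookup cycleArcs-⇾ e∈))) (proj₂ (All.lookup cycleArcs-⇾ e∈))

  -- Reversing the closing arc of the bottom row turns circulations into arc sets whose
  -- boundary is that of an extra unit entering at its end and leaving at its start.
  count-cycleArcs : count isZero cycleArcs 𝟘 ≡ true
  count-cycleArcs = begin
    count isZero (ladderTail rung) (𝟘 ⊕ ∂ bottom) xor count isZero (ladderTail rung) 𝟘
      ≡⟨ cong₂ _xor_ (count-resp isZero-resp (ladderTail rung) λ v → ℤ.+-identityˡ (∂ bottom v))
                     (count-resp isZero-resp (ladderTail rung) λ v → cancel (δ (rung zero (fromℕ c)) v) (δ (rung zero zero) v)) ⟩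
    count isZero (ladderTail rung) (∂ bottom) xor count isZero (ladderTail rung) (∂ bottom ⊕ (rung zero zero ⊖ rung zero (fromℕ c)))
      ≡⟨ Bool.xor-comm (count isZero (ladderTail rung) (∂ bottom)) _ ⟩
    count isZero (ladder rung) (∂ bottom)
      -- The boundary of `bottom` is the case where `j` is the last index `fromℕ c`, which differs
      -- from `zero`.
      ≡⟨ count-ladder even′ level 0 rung (λ _ _ → refl) rung-injective (fromℕ c) ⟩
    true ∎
    where
    open ≡-Reasoning
    cancel : ∀ a b → 0ℤ ≡ a - b + (b - a)
    cancel = solve-∀
    even′ : odd c ≡ false
    even′ = trans (Bool.not-involutive (odd c″)) even

  odd-circulations : count isZero (arcs G D) 𝟘 ≡ true
  odd-circulations = begin
    count isZero (arcs G D) 𝟘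
      ≡⟨ count-arcs-drop G D potential (λ {u} {v} → potential-mono {u} {v}) ⟩
    count isZero levelArcs 𝟘
      ≡⟨ count-↭ isZero-resp levelArcs↭cycleArcs 𝟘 ⟩
    count isZero cycleArcs 𝟘
      ≡⟨ count-cycleArcs ⟩
    true ∎
    where open ≡-Reasoning

  -- The wrap-around to `zero` gives the tail of a closing arc in a row; along a copy of the path it
  -- is only a filler value for the last layer.
  next : ∀ {k} → Fin (suc k) → Fin (suc k)
  next {k} i with suc (toℕ i) ℕ.<? suc k
  ... | yes i<k = fromℕ< i<k
  ... | no  _   = zero

  next-step : ∀ {k} {i j : Fin (suc k)} → suc (toℕ i) ≡ toℕ j → j ≡ next i
  next-step {k} {i} {j} p with suc (toℕ i) ℕ.<? suc k
  ... | yes i<k = fin-≡ {i = j} refl (trans (Fin.toℕ-fromℕ< i<k) p)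
  ... | no  i≮k = contradiction (subst (_< suc k) (sym p) (Fin.toℕ<n j)) i≮k

  next-last : ∀ {k} {i j : Fin (suc k)} → toℕ j ≡ k → toℕ i ≡ 0 → i ≡ next j
  next-last {k} {i} {j} p q with suc (toℕ j) ℕ.<? suc k
  ... | yes j<k = contradiction (ℕ.≤-pred j<k) (ℕ.<-irrefl p)
  ... | no  _   = fin-≡ {j = zero} q refl

  pred-step : ∀ {k} {i j : Fin (suc k)} → suc (toℕ i) ≡ toℕ j → i ≡ Fin.pred j
  pred-step {j = suc j} p = fin-≡ (ℕ.suc-injective p) (Fin.toℕ-inject₁ j)

  -- The end of the second arc into a cycle vertex that does not come from K m.
  partner : Fin (suc c) → Fin (suc n) → Vertex
  -- No vertical arc enters this vertex, which leaves room for the reversed closing arc.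
  partner zero    zero    = rung zero (fromℕ c)
  partner zero    (suc t) = rung (inject₁ t) zero
  partner (suc i) t       = rung (next t) (suc i)

  -- Padded to the common length `2 + m`: for instance, a vertex of `K m` appears in its own list,
  -- so that one bound serves all vertices.
  sources : Vertex → List Vertex
  sources (inj₁ b , t) = (inj₁ b , t) ∷ (inj₁ b , Fin.pred t) ∷ map (λ a → inj₁ a , t) (allFin m)
  sources (inj₂ j , t) = rung t (next j) ∷ partner j t ∷ map (λ a → inj₁ a , t) (allFin m)

  length-sources : ∀ v → length (sources v) ≡ 2 ℕ.+ m
  length-sources (inj₁ b , t) = cong (2 ℕ.+_) (trans (length-map (λ a → inj₁ a , t) (allFin m)) (length-tabulate {n = m} (λ i → i)))
  length-sources (inj₂ j , t) = cong (2 ℕ.+_) (trans (length-map (λ a → inj₁ a , t) (allFin m)) (length-tabulate {n = m} (λ i → i)))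

  ∈-sources : ∀ v u → u ⇾ v → u ∈ sources v
  ∈-sources (inj₁ b , t) (inj₁ a , t′) (inj₁ (refl , _)) = there (there (∈-map⁺ (λ a → inj₁ a , t) (∈-allFin a)))
  ∈-sources (inj₁ b , t) (inj₁ a , t′) (inj₂ (refl , p)) = there (here (cong (inj₁ b ,_) (pred-step p)))
  ∈-sources (inj₂ j , t) (inj₁ a , t′) refl = there (there (∈-map⁺ (λ a → inj₁ a , t) (∈-allFin a)))
  ∈-sources (inj₂ j , t) (inj₂ i , t′) (inj₁ (refl , p)) = row-source t p
    where
    row-source : ∀ t {i j} → RowArc t i j → rung t i ∈ sources (rung t j)
    row-source zero    (inj₁ p) = here (cong (rung zero) (next-step p))
    row-source (suc t) (inj₁ p) = here (cong (rung (suc t)) (next-step p))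
    row-source (suc t) (inj₂ (p , q)) = here (cong (rung (suc t)) (next-last q p))
    row-source zero    {i} {zero} (inj₂ (p , _)) = there (here (cong (rung zero) (fin-≡ {i = i} p (Fin.toℕ-fromℕ c))))
  ∈-sources (inj₂ j , t) (inj₂ i , t′) (inj₂ (refl , p)) = rung-source j p
    where
    rung-source : ∀ i {t t′} → RungArc i t t′ → rung t i ∈ sources (rung t′ i)
    rung-source zero {t} {suc t′} p = there (here (cong (λ t → rung t zero) (pred-step {j = suc t′} p)))
    rung-source (suc i) p = there (here (cong (λ t → rung t (suc i)) (next-step p)))

  maxIndegree≤ : maxIndegree G D ≤ 2 ℕ.+ m
  maxIndegree≤ = maxIndegree-≤ G D (2 ℕ.+ m) λ v →
    subst (indegree G (arcs G D) v ≤_) (length-sources v) (indegree-arcs G D v (sources v) (∈-sources v))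

-- The chromatic number

-- Steps of two lead from index `zero` to the last index, which is even. In an odd cycle these two
-- indices are adjacent.
alternate-ends : ∀ {k} {A : Set} (g : Fin (3 ℕ.+ k) → A) → odd k ≡ false →
  (∀ i → g (inject₁ (inject₁ i)) ≡ g (suc (suc i))) → g zero ≡ g (fromℕ (2 ℕ.+ k))
alternate-ends {zero}        g even g≡ = g≡ zero
alternate-ends {suc (suc k)} g even g≡ = trans (g≡ zero)
  (alternate-ends (λ i → g (suc (suc i))) (trans (sym (Bool.not-involutive (odd k))) even) (λ i → g≡ (suc (suc i))))

-- If vertices at distance two along the indices always shared a colour, so would the adjacent ends
-- of the cycle. Hence three consecutive vertices of the bottom cycle have distinct colours, and
-- with the `m` vertices joined to them they give an injection into the colours.
colorable⇒≥ : ∀ m c″ n → odd c″ ≡ false → ∀ {j} → Colorable ((K m ∨ C (3 ℕ.+ c″)) □ P (suc n)) j → 3 ℕ.+ m ≤ j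
colorable⇒≥ m c″ n even {j} (f , f-proper) = search (Fin.any? λ i → ¬? (g (inject₁ (inject₁ i)) Fin.≟ g (suc (suc i))))
  where
  open FiniteSimpleGraph using (_~_)

  g : Fin (3 ℕ.+ c″) → Fin j
  g i = f (inj₂ i , zero)

  g-≢ : ∀ {i i′} → _~_ (C (3 ℕ.+ c″)) i i′ → g i ≢ g i′
  g-≢ {i} {i′} i~i′ = f-proper {inj₂ i , zero} {inj₂ i′ , zero} (inj₂ (refl , i~i′))

  step-≢ : ∀ {i i′} → suc (toℕ i) ≡ toℕ i′ → g i ≢ g i′
  step-≢ p = g-≢ ((λ { refl → ℕ.1+n≢n p }) , inj₁ (inj₁ p))

  hub-≢ : ∀ a i → f (inj₁ a , zero) ≢ g i
  hub-≢ a i = f-proper {inj₁ a , zero} {inj₂ i , zero} (inj₂ (refl , _))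

  hub-injective : ∀ {a b} → f (inj₁ a , zero) ≡ f (inj₁ b , zero) → a ≡ b
  hub-injective {a} {b} eq with a Fin.≟ b
  ... | yes a≡b = a≡b
  ... | no  a≢b = contradiction eq (f-proper {inj₁ a , zero} {inj₁ b , zero} (inj₂ (refl , a≢b , inj₁ _)))

  search : Dec (∃[ i ] g (inject₁ (inject₁ i)) ≢ g (suc (suc i))) → 3 ℕ.+ m ≤ j
  search (no none) = contradiction
    (alternate-ends g even λ i → decidable-stable (g (inject₁ (inject₁ i)) Fin.≟ g (suc (suc i))) λ ≢ → none (i , ≢))
    (≢-sym (g-≢ ((λ ()) , inj₁ (inj₂ (cong (3 ℕ.+_) (Fin.toℕ-fromℕ c″) , refl)))))
  search (yes (i , g₀≢g₂)) = Fin.injective⇒≤ {f = colours} λ {x} {y} → colours-injective x y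
    where
    g₀≢g₁ : g (inject₁ (inject₁ i)) ≢ g (suc (inject₁ i))
    g₀≢g₁ = step-≢ (cong suc (Fin.toℕ-inject₁ (inject₁ i)))

    g₁≢g₂ : g (suc (inject₁ i)) ≢ g (suc (suc i))
    g₁≢g₂ = step-≢ (cong (2 ℕ.+_) (Fin.toℕ-inject₁ i))

    colours : Fin (3 ℕ.+ m) → Fin j
    colours zero                = g (inject₁ (inject₁ i))
    colours (suc zero)          = g (suc (inject₁ i))
    colours (suc (suc zero))    = g (suc (suc i))
    colours (suc (suc (suc a))) = f (inj₁ a , zero)

    colours-injective : ∀ x y → colours x ≡ colours y → x ≡ y
    colours-injective zero                zero                eq = refl
    colours-injective zero                (suc zero)          eq = contradiction eq g₀≢g₁
    colours-injective zero                (suc (suc zero))    eq = contradiction eq g₀≢g₂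
    colours-injective zero                (suc (suc (suc b))) eq = contradiction (sym eq) (hub-≢ b _)
    colours-injective (suc zero)          zero                eq = contradiction (sym eq) g₀≢g₁
    colours-injective (suc zero)          (suc zero)          eq = refl
    colours-injective (suc zero)          (suc (suc zero))    eq = contradiction eq g₁≢g₂
    colours-injective (suc zero)          (suc (suc (suc b))) eq = contradiction (sym eq) (hub-≢ b _)
    colours-injective (suc (suc zero))    zero                eq = contradiction (sym eq) g₀≢g₂
    colours-injective (suc (suc zero))    (suc zero)          eq = contradiction (sym eq) g₁≢g₂
    colours-injective (suc (suc zero))    (suc (suc zero))    eq = refl
    colours-injective (suc (suc zero))    (suc (suc (suc b))) eq = contradiction (sym eq) (hub-≢ b _)
    colours-injective (suc (suc (suc a))) zero                eq = contradiction eq (hub-≢ a _)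
    colours-injective (suc (suc (suc a))) (suc zero)          eq = contradiction eq (hub-≢ a _)
    colours-injective (suc (suc (suc a))) (suc (suc zero))    eq = contradiction eq (hub-≢ a _)
    colours-injective (suc (suc (suc a))) (suc (suc (suc b))) eq = cong (λ a → suc (suc (suc a))) (hub-injective eq)

-- The Alon-Tarsi number and chromatic-choosability of the product

alonTarsiNumber : ∀ m c″ n → odd c″ ≡ false →
  IsAlonTarsiNumber ((K m ∨ C (3 ℕ.+ c″)) □ P (suc n)) (3 ℕ.+ m) ×
  ChromaticChoosable ((K m ∨ C (3 ℕ.+ c″)) □ P (suc n))
alonTarsiNumber m c″ n even = certificate ((K m ∨ C (3 ℕ.+ c″)) □ P (suc n)) (Tower.D m c″ n even) {2 ℕ.+ m}
  (Tower.odd-circulations m c″ n even) (Tower.maxIndegree≤ m c″ n even) (colorable⇒≥ m c″ n even)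

corollary11 : (m k n : ℕ) .{{_ : NonZero m}} .{{_ : NonZero k}} .{{_ : NonZero n}} →
    IsAlonTarsiNumber ((K m ∨ C (2 ℕ.* k ℕ.+ 1)) □ P n) (m ℕ.+ 3) ×
    ChromaticChoosable ((K m ∨ C (2 ℕ.* k ℕ.+ 1)) □ P n)
corollary11 m zero    n       = contradiction refl (ℕ.≢-nonZero⁻¹ 0)
corollary11 m (suc k) zero    = contradiction refl (ℕ.≢-nonZero⁻¹ 0)
-- The cycle length `2 * suc k + 1` is `3 + (k + k)`, so `c″` is the even number `k + k`.
corollary11 m (suc k) (suc n) = transport (length-≡ k) (ℕ.+-comm 3 m)
  where
  length-≡ : ∀ k → 3 ℕ.+ (k ℕ.+ k) ≡ 2 ℕ.* suc k ℕ.+ 1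
  length-≡ = solveℕ-∀

  transport : ∀ {N j} → 3 ℕ.+ (k ℕ.+ k) ≡ N → 3 ℕ.+ m ≡ j →
    IsAlonTarsiNumber ((K m ∨ C N) □ P (suc n)) j × ChromaticChoosable ((K m ∨ C N) □ P (suc n))
  transport refl refl = alonTarsiNumber m (k ℕ.+ k) n (odd-double k)
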